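{- For $n\ge 1$, $$G_n(q) = \sum_{i=0}^{n-1}\binom{n-1}{i}\, q^{\ln(i+1)}\, G_i(q)\, G_{n-1-i}(q).$$
   Context: Write $[n]=\{1,\dots,n\}$. A street has parking spots $1,\dots,n$ in order, and cars $c_1,\dots,c_n$ arrive in this order. Given $\alpha=(a_1,\dots,a_n)\in[n]^n$, car $c_i$ drives to its preferred spot $a_i$ and parks there if it is empty; otherwise it continues forward and parks in the first empty spot after $a_i$, if there is one (otherwise it fails to park). The tuple $\alpha$ is a parking function of length $n$ if all $n$ cars park; $PF_n$ is the set of parking functions of length $n$. The map $\varphi:PF_n\to S_n$ sends $\alpha$ to the permutation $s_1s_2\cdots s_n$ (one-line notation), where spot $i$ is occupied by car $c_{s_i}$ after all cars have parked. For $n\ge 0$, $c_{n,i}$ is the number of permutations $\sigma\in S_n$ with $|\varphi^{ -1}(\sigma)|=i$; for $n=0$ there is one (empty) permutation and one (empty) parking function, so $c_{0,1}=1$ and $c_{0,i}=0$ for $i\ne1$. The logarithmic generating function is $$G_n(q)=\sum_{i=1}^{n!} c_{n,i}\, q^{\ln i},$$ with $\ln$ the natural logarithm; in particular $G_0(q)=1$. Here $q$ is a formal variable with real exponents, $q^{r}q^{s}=q^{r+s}$ and $q^0=1$. -}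

module Defs where

open import Data.Fin using (Fin; zero; suc)
import Data.Fin.Properties as Fin
import Data.Integer as ℤ
import Data.Integer.Properties as ℤ
open import Data.List using (List; []; _∷_; _++_; length; filter; foldl; upTo; allFin; cartesianProductWith)
import Data.List as List
open import Data.Maybe using (Maybe; just; nothing; _>>=_; Is-just)
import Data.Maybe as Maybe
import Data.Maybe.Properties as Maybe
import Data.Maybe.Relation.Unary.Any as MaybeAny
open import Data.Nat using (ℕ; zero; suc; _∸_; NonZero; _!)
import Data.Nat as ℕ
import Data.Nat.Properties as ℕ
open import Data.Product using (_×_; _,_)
open import Data.Rational.Unnormalised
  using (ℚᵘ; 0ℚᵘ; _/_; _+_; _-_; -_; _≤_; _≃_; *≡*; *≤*; ∣_∣)
open import Data.Rational.Unnormalised.Properties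
open import Data.Rational.Unnormalised.Solver using (module +-*-Solver)
open import Data.Sum using (inj₁; inj₂)
open import Data.Unit using (tt)
open import Data.Vec using (Vec; []; _∷_; lookup; replicate)
import Data.Vec as Vec
import Data.Vec.Properties as Vec
open import Data.Vec.Relation.Unary.AllPairs using (allPairs?)
open import Data.Vec.Relation.Unary.Unique.Propositional using (Unique)
open import Relation.Binary.PropositionalEquality using (_≡_; refl; sym; trans; cong; subst)
open import Relation.Nullary using (Dec; ¬?; yes; no)
open import Relation.Unary using (Decidable)

------------------------------------------------------------------------
-- Real numbers, as Bishop's regular sequences of rationals

record ℝ : Set where
  constructor mkℝ
  field
    approx  : (k : ℕ) .{{_ : NonZero k}} → ℚᵘ
    regular : ∀ j k .{{_ : NonZero j}} .{{_ : NonZero k}} →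
              ∣ approx j - approx k ∣ ≤ ℤ.+ 1 / j + ℤ.+ 1 / k

open ℝ public

infix 4 _≃ℝ_

_≃ℝ_ : ℝ → ℝ → Set
x ≃ℝ y = ∀ k .{{_ : NonZero k}} → ∣ approx x k - approx y k ∣ ≤ ℤ.+ 2 / k

/-cong-denominator : ∀ p {j k} .{{_ : NonZero j}} .{{_ : NonZero k}} →
                     j ≡ k → p / j ≃ p / k
/-cong-denominator p refl = ≃-refl

/-antitone : ∀ p {j k} .{{_ : NonZero j}} .{{_ : NonZero k}} →
             j ℕ.≤ k → ℤ.+ p / k ≤ ℤ.+ p / j
/-antitone p {suc j} {suc k} j≤k =
  *≤* (ℤ.*-monoˡ-≤-nonNeg (ℤ.+ p) (ℤ.+≤+ j≤k))

/-add : ∀ p q d .{{_ : NonZero d}} → ℤ.+ p / d + ℤ.+ q / d ≃ ℤ.+ (p ℕ.+ q) / d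
/-add p q (suc d) = *≡* (trans (cong (ℤ._* ℤ.+ suc d) (sym (ℤ.*-distribʳ-+ (ℤ.+ suc d) (ℤ.+ p) (ℤ.+ q))))
  (trans (ℤ.*-assoc (ℤ.+ (p ℕ.+ q)) (ℤ.+ suc d) (ℤ.+ suc d))
         (cong (ℤ.+ (p ℕ.+ q) ℤ.*_) (sym (ℤ.pos-* (suc d) (suc d))))))

/-reduce : ∀ k m .{{_ : NonZero k}} .{{_ : NonZero m}} .{{_ : NonZero (k ℕ.* m)}} →
           ℤ.+ m / (k ℕ.* m) ≃ ℤ.+ 1 / k
/-reduce (suc k) (suc m) = *≡* (trans (sym (ℤ.pos-* (suc m) (suc k)))
  (trans (cong ℤ.+_ (ℕ.*-comm (suc m) (suc k)))
         (sym (ℤ.*-identityˡ (ℤ.+ (suc k ℕ.* suc m))))))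

half+half : ∀ k .{{_ : NonZero k}} →
            (ℤ.+ 1 / (2 ℕ.* k)) {{ℕ.m*n≢0 2 k}} + (ℤ.+ 1 / (2 ℕ.* k)) {{ℕ.m*n≢0 2 k}} ≃ ℤ.+ 1 / k
half+half k@(suc _) = ≃-trans (/-add 1 1 (2 ℕ.* k)) (≃-trans
  (/-cong-denominator (ℤ.+ 2) {{_}} {{ℕ.m*n≢0 k 2}} (ℕ.*-comm 2 k)) (/-reduce k 2))

∣-∣-bound : ∀ p q e → p ≤ q + e → q ≤ p + e → ∣ p - q ∣ ≤ e
∣-∣-bound p q e p≤q+e q≤p+e with ∣p∣≡p∨∣p∣≡-p (p - q)
... | inj₁ eq = subst (_≤ e) (sym eq) (begin
  p - q       ≤⟨ +-monoˡ-≤ (- q) p≤q+e ⟩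
  q + e - q   ≃⟨ solve 2 (λ x y → x :+ y :- x := y) ≃-refl q e ⟩
  e           ∎)
  where open ≤-Reasoning; open +-*-Solver
... | inj₂ eq = subst (_≤ e) (sym eq) (begin
  - (p - q)   ≃⟨ solve 2 (λ x y → :- (x :- y) := y :- x) ≃-refl p q ⟩
  q - p       ≤⟨ +-monoˡ-≤ (- p) q≤p+e ⟩
  p + e - p   ≃⟨ solve 2 (λ x y → x :+ y :- x := y) ≃-refl p e ⟩
  e           ∎)
  where open ≤-Reasoning; open +-*-Solver

infixl 6 _+ℝ_

_+ℝ_ : ℝ → ℝ → ℝ
(x +ℝ y) .approx k = approx x (2 ℕ.* k) + approx y (2 ℕ.* k)
  where instance _ = ℕ.m*n≢0 2 k
(x +ℝ y) .regular j k = begin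
  ∣ (a + b) - (c + d) ∣              ≃⟨ ∣-∣-cong (solve 4 (λ a b c d → (a :+ b) :- (c :+ d) := (a :- c) :+ (b :- d)) ≃-refl a b c d) ⟩
  ∣ (a - c) + (b - d) ∣              ≤⟨ ∣p+q∣≤∣p∣+∣q∣ (a - c) (b - d) ⟩
  ∣ a - c ∣ + ∣ b - d ∣              ≤⟨ +-mono-≤ (regular x (2 ℕ.* j) (2 ℕ.* k)) (regular y (2 ℕ.* j) (2 ℕ.* k)) ⟩
  (u + v) + (u + v)                  ≃⟨ solve 2 (λ u v → (u :+ v) :+ (u :+ v) := (u :+ u) :+ (v :+ v)) ≃-refl u v ⟩
  (u + u) + (v + v)                  ≃⟨ +-cong (half+half j) (half+half k) ⟩
  ℤ.+ 1 / j + ℤ.+ 1 / k              ∎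
  where
  open ≤-Reasoning
  open +-*-Solver
  instance
    _ = ℕ.m*n≢0 2 j
    _ = ℕ.m*n≢0 2 k
  a = approx x (2 ℕ.* j)
  b = approx y (2 ℕ.* j)
  c = approx x (2 ℕ.* k)
  d = approx y (2 ℕ.* k)
  u = ℤ.+ 1 / (2 ℕ.* j)
  v = ℤ.+ 1 / (2 ℕ.* k)

------------------------------------------------------------------------
-- The natural logarithm of a positive integer

-- harmonic k N = 1/k + 1/(k+1) + ⋯ + 1/(k+N-1)
harmonic : (k : ℕ) .{{_ : NonZero k}} → ℕ → ℚᵘ
harmonic k zero    = 0ℚᵘ
harmonic k (suc N) = ℤ.+ 1 / k + harmonic (suc k) N

harmonic-cong : ∀ {j k} .{{_ : NonZero j}} .{{_ : NonZero k}} {M N} →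
                j ≡ k → M ≡ N → harmonic j M ≃ harmonic k N
harmonic-cong refl refl = ≃-refl

harmonic-++ : ∀ k M N .{{_ : NonZero k}} .{{_ : NonZero (k ℕ.+ M)}} →
              harmonic k (M ℕ.+ N) ≃ harmonic k M + harmonic (k ℕ.+ M) N
harmonic-++ k zero    N = ≃-trans (harmonic-cong {M = N} (sym (ℕ.+-identityʳ k)) refl)
                                  (≃-sym (+-identityˡ (harmonic (k ℕ.+ 0) N)))
harmonic-++ k (suc M) N = begin
  ℤ.+ 1 / k + harmonic (suc k) (M ℕ.+ N)
    ≈⟨ +-congʳ (ℤ.+ 1 / k) (harmonic-++ (suc k) M N) ⟩
  ℤ.+ 1 / k + (harmonic (suc k) M + harmonic (suc k ℕ.+ M) N)
    ≈⟨ +-assoc (ℤ.+ 1 / k) (harmonic (suc k) M) (harmonic (suc k ℕ.+ M) N) ⟨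
  harmonic k (suc M) + harmonic (suc k ℕ.+ M) N
    ≈⟨ +-congʳ (harmonic k (suc M)) (harmonic-cong {M = N} (sym (ℕ.+-suc k M)) refl) ⟩
  harmonic k (suc M) + harmonic (k ℕ.+ suc M) N  ∎
  where open ≃-Reasoning

harmonic-upper : ∀ d k N .{{_ : NonZero d}} .{{_ : NonZero k}} →
                 d ℕ.≤ k → harmonic k N ≤ ℤ.+ N / d
harmonic-upper (suc d) k zero    d≤k = *≤* (ℤ.+≤+ ℕ.z≤n)
harmonic-upper d k (suc N) d≤k = begin
  ℤ.+ 1 / k + harmonic (suc k) N   ≤⟨ +-mono-≤ (/-antitone 1 d≤k) (harmonic-upper d (suc k) N (ℕ.m≤n⇒m≤1+n d≤k)) ⟩
  ℤ.+ 1 / d + ℤ.+ N / d            ≃⟨ /-add 1 N d ⟩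
  ℤ.+ suc N / d                    ∎
  where open ≤-Reasoning

harmonic-lower : ∀ d k N .{{_ : NonZero d}} .{{_ : NonZero k}} →
                 k ℕ.+ N ℕ.≤ d → ℤ.+ N / d ≤ harmonic k N
harmonic-lower (suc d) k zero    k≤d = *≤* (ℤ.+≤+ ℕ.z≤n)
harmonic-lower d k (suc N) k≤d = begin
  ℤ.+ suc N / d                    ≃⟨ /-add 1 N d ⟨
  ℤ.+ 1 / d + ℤ.+ N / d            ≤⟨ +-mono-≤ (/-antitone 1 (ℕ.≤-trans (ℕ.m≤m+n k (suc N)) k≤d))
                                               (harmonic-lower d (suc k) N (subst (ℕ._≤ d) (ℕ.+-suc k N) k≤d)) ⟩
  ℤ.+ 1 / k + harmonic (suc k) N   ∎
  where open ≤-Reasoning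

module _ (m : ℕ) .{{_ : NonZero m}} where

  private
    harmonic-block : ∀ k N .{{_ : NonZero k}} .{{_ : NonZero (k ℕ.* m)}} →
      harmonic (k ℕ.* m) (suc N ℕ.* m) ≃
      harmonic (k ℕ.* m) m + harmonic (suc k ℕ.* m) {{ℕ.m*n≢0 (suc k) m}} (N ℕ.* m)
    harmonic-block k N = ≃-trans (harmonic-++ (k ℕ.* m) m (N ℕ.* m))
      (+-congʳ (harmonic (k ℕ.* m) m)
               (harmonic-cong {M = N ℕ.* m} (ℕ.+-comm (k ℕ.* m) m) refl))
      where instance _ = subst NonZero (ℕ.+-comm m (k ℕ.* m)) (ℕ.m*n≢0 (suc k) m)
                     _ = ℕ.m*n≢0 (suc k) m

  harmonic-refine-≤ : ∀ k N .{{_ : NonZero k}} .{{_ : NonZero (k ℕ.* m)}} →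
    harmonic (k ℕ.* m) (N ℕ.* m) ≤ harmonic k N
  harmonic-refine-≤ k zero    = ≤-refl
  harmonic-refine-≤ k (suc N) = begin
    harmonic (k ℕ.* m) (suc N ℕ.* m)
      ≃⟨ harmonic-block k N ⟩
    harmonic (k ℕ.* m) m + harmonic (suc k ℕ.* m) (N ℕ.* m)
      ≤⟨ +-mono-≤ (harmonic-upper (k ℕ.* m) (k ℕ.* m) m ℕ.≤-refl) (harmonic-refine-≤ (suc k) N) ⟩
    ℤ.+ m / (k ℕ.* m) + harmonic (suc k) N
      ≃⟨ +-congˡ (harmonic (suc k) N) (/-reduce k m) ⟩
    harmonic k (suc N) ∎
    where open ≤-Reasoning
          instance _ = ℕ.m*n≢0 (suc k) m

  harmonic-refine-≥ : ∀ k N .{{_ : NonZero k}} .{{_ : NonZero (k ℕ.* m)}} →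
    .{{_ : NonZero (k ℕ.+ N)}} →
    harmonic k N + ℤ.+ 1 / (k ℕ.+ N) ≤ harmonic (k ℕ.* m) (N ℕ.* m) + ℤ.+ 1 / k
  harmonic-refine-≥ k zero    = ≤-reflexive (+-congʳ 0ℚᵘ (/-cong-denominator (ℤ.+ 1) (ℕ.+-identityʳ k)))
  harmonic-refine-≥ k (suc N) = begin
    harmonic k (suc N) + ℤ.+ 1 / (k ℕ.+ suc N)
      ≃⟨ +-congʳ (harmonic k (suc N)) (/-cong-denominator (ℤ.+ 1) (ℕ.+-suc k N)) ⟩
    ℤ.+ 1 / k + harmonic (suc k) N + ℤ.+ 1 / (suc k ℕ.+ N)
      ≃⟨ +-assoc (ℤ.+ 1 / k) (harmonic (suc k) N) (ℤ.+ 1 / (suc k ℕ.+ N)) ⟩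
    ℤ.+ 1 / k + (harmonic (suc k) N + ℤ.+ 1 / (suc k ℕ.+ N))
      ≤⟨ +-monoʳ-≤ (ℤ.+ 1 / k) (harmonic-refine-≥ (suc k) N) ⟩
    ℤ.+ 1 / k + (rest + ℤ.+ 1 / suc k)
      ≤⟨ +-monoʳ-≤ (ℤ.+ 1 / k) (+-monoʳ-≤ rest (≤-trans (≤-reflexive (≃-sym (/-reduce (suc k) m)))
           (harmonic-lower (suc k ℕ.* m) (k ℕ.* m) m (ℕ.≤-reflexive (ℕ.+-comm (k ℕ.* m) m))))) ⟩
    ℤ.+ 1 / k + (rest + harmonic (k ℕ.* m) m)
      ≃⟨ solve 3 (λ a b c → a :+ (b :+ c) := (c :+ b) :+ a) ≃-refl (ℤ.+ 1 / k) rest (harmonic (k ℕ.* m) m) ⟩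
    harmonic (k ℕ.* m) m + rest + ℤ.+ 1 / k
      ≃⟨ +-congˡ (ℤ.+ 1 / k) (harmonic-block k N) ⟨
    harmonic (k ℕ.* m) (suc N ℕ.* m) + ℤ.+ 1 / k ∎
    where open ≤-Reasoning
          open +-*-Solver
          instance _ = ℕ.m*n≢0 (suc k) m
          rest = harmonic (suc k ℕ.* m) (N ℕ.* m)

-- ln n = ∫₁ⁿ dx/x.  The k-th approximation is the left Riemann sum with mesh
-- 1/k, namely Σ (1/k) · 1/(1 + i/k) = Σ 1/(k + i) over 0 ≤ i < (n-1)k.
lnApprox : (n k : ℕ) .{{_ : NonZero k}} → ℚᵘ
lnApprox n k = harmonic k ((n ∸ 1) ℕ.* k)

lnApprox-refine-≤ : ∀ n j k .{{_ : NonZero j}} .{{_ : NonZero k}} .{{_ : NonZero (j ℕ.* k)}} →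
                    lnApprox n (j ℕ.* k) ≤ lnApprox n j
lnApprox-refine-≤ n j k = ≤-trans
  (≤-reflexive (harmonic-cong {j = j ℕ.* k} refl (sym (ℕ.*-assoc (n ∸ 1) j k))))
  (harmonic-refine-≤ k j ((n ∸ 1) ℕ.* j))

lnApprox-refine-≥ : ∀ n j k .{{_ : NonZero j}} .{{_ : NonZero k}} .{{_ : NonZero (j ℕ.* k)}} →
                    lnApprox n j ≤ lnApprox n (j ℕ.* k) + ℤ.+ 1 / j
lnApprox-refine-≥ n j@(suc _) k = begin
  lnApprox n j                            ≤⟨ p≤p+q (lnApprox n j) (ℤ.+ 1 / (j ℕ.+ N)) ⟩
  lnApprox n j + ℤ.+ 1 / (j ℕ.+ N)        ≤⟨ harmonic-refine-≥ k j N ⟩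
  harmonic (j ℕ.* k) (N ℕ.* k) + ℤ.+ 1 / j
    ≃⟨ +-congˡ (ℤ.+ 1 / j) (harmonic-cong {j = j ℕ.* k} refl (ℕ.*-assoc (n ∸ 1) j k)) ⟩
  lnApprox n (j ℕ.* k) + ℤ.+ 1 / j        ∎
  where open ≤-Reasoning
        N = (n ∸ 1) ℕ.* j

lnApprox-≤ : ∀ n j k .{{_ : NonZero j}} .{{_ : NonZero k}} →
             lnApprox n j ≤ lnApprox n k + (ℤ.+ 1 / j + ℤ.+ 1 / k)
lnApprox-≤ n j@(suc _) k@(suc _) = begin
  lnApprox n j                         ≤⟨ lnApprox-refine-≥ n j k ⟩
  lnApprox n (j ℕ.* k) + ℤ.+ 1 / j     ≃⟨ +-congˡ (ℤ.+ 1 / j) (harmonic-cong (ℕ.*-comm j k) (cong ((n ∸ 1) ℕ.*_) (ℕ.*-comm j k))) ⟩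
  lnApprox n (k ℕ.* j) + ℤ.+ 1 / j     ≤⟨ +-mono-≤ (lnApprox-refine-≤ n k j) (p≤p+q (ℤ.+ 1 / j) (ℤ.+ 1 / k)) ⟩
  lnApprox n k + (ℤ.+ 1 / j + ℤ.+ 1 / k) ∎
  where open ≤-Reasoning

ln : (n : ℕ) .{{_ : NonZero n}} → ℝ
ln n .approx      = lnApprox n
ln n .regular j k = ∣-∣-bound (lnApprox n j) (lnApprox n k) _ (lnApprox-≤ n j k)
  (≤-trans (lnApprox-≤ n k j) (+-monoʳ-≤ (lnApprox n j) (≤-reflexive (+-comm (ℤ.+ 1 / k) (ℤ.+ 1 / j)))))

------------------------------------------------------------------------
-- Formal sums of powers of q with real exponents: the monoid semiring ℕ[ℝ,+]

-- The list (c₁ , r₁) ∷ (c₂ , r₂) ∷ ⋯ stands for c₁ q^r₁ + c₂ q^r₂ + ⋯.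
FormalSum : Set
FormalSum = List (ℕ × ℝ)

infix 4 _≈_

-- Equality in ℕ[ℝ,+], the free ℕ-semimodule on the setoid of reals, by its
-- presentation.  (Comparing coefficients of each power directly would need
-- a decidable equality on ℝ.)
data _≈_ : FormalSum → FormalSum → Set where
  ≈-refl   : ∀ {f} → f ≈ f
  ≈-sym    : ∀ {f g} → f ≈ g → g ≈ f
  ≈-trans  : ∀ {f g h} → f ≈ g → g ≈ h → f ≈ h
  prep     : ∀ t {f g} → f ≈ g → t ∷ f ≈ t ∷ g
  swap     : ∀ s t {f} → s ∷ t ∷ f ≈ t ∷ s ∷ f
  exponent : ∀ c {r s f} → r ≃ℝ s → (c , r) ∷ f ≈ (c , s) ∷ f
  collect  : ∀ c d r {f} → (c , r) ∷ (d , r) ∷ f ≈ (c ℕ.+ d , r) ∷ f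
  vanish   : ∀ r {f} → (0 , r) ∷ f ≈ f

infixl 6 _⊕_
infixl 7 _⊗_
infixr 8 _·_
infix  9 q^_

q^_ : ℝ → FormalSum
q^ r = (1 , r) ∷ []

_⊕_ : FormalSum → FormalSum → FormalSum
_⊕_ = _++_

_⊗_ : FormalSum → FormalSum → FormalSum
_⊗_ = cartesianProductWith λ (c , r) (d , s) → (c ℕ.* d , r +ℝ s)

_·_ : ℕ → FormalSum → FormalSum
c · f = List.map (λ (d , r) → (c ℕ.* d , r)) f

∑ : ℕ → (ℕ → FormalSum) → FormalSum
∑ n f = List.foldr _⊕_ [] (List.map f (upTo n))

infix 5 ∑
syntax ∑ n (λ i → f) = ∑[ i < n ] f

------------------------------------------------------------------------
-- Parking functions.  Cars and spots 1, …, n are numbered from 0 by Fin n.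

Street : ℕ → Set
Street n = Vec (Maybe (Fin n)) n

-- The car c drives from the start of the given stretch of road to spot a, and
-- takes the first empty spot from a onwards; `nothing` if there is none.
park : ∀ {C : Set} {k} → C → Fin k → Vec (Maybe C) k → Maybe (Vec (Maybe C) k)
park c (suc a) (x       ∷ xs)         = Maybe.map (x ∷_) (park c a xs)
park c zero    (nothing ∷ xs)         = just (just c ∷ xs)
park c zero    (just d  ∷ [])         = nothing
park c zero    (just d  ∷ xs@(_ ∷ _)) = Maybe.map (just d ∷_) (park c zero xs)

-- The street after all cars have arrived; `nothing` if some car fails to park.
outcome : ∀ {n} → Vec (Fin n) n → Maybe (Street n)
outcome {n} α = foldl (λ street c → street >>= park c (lookup α c))
                      (just (replicate n nothing)) (allFin n)

-- [n]^k, each tuple listed once.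
tuples : ∀ n k → List (Vec (Fin n) k)
tuples n zero    = [] ∷ []
tuples n (suc k) = cartesianProductWith _∷_ (allFin n) (tuples n k)

IsParkingFunction : ∀ {n} → Vec (Fin n) n → Set
IsParkingFunction α = Is-just (outcome α)

isParkingFunction? : ∀ {n} → Decidable (IsParkingFunction {n})
isParkingFunction? α = MaybeAny.dec (λ _ → yes tt) (outcome α)

PF : ∀ n → List (Vec (Fin n) n)
PF n = filter isParkingFunction? (tuples n n)

unique? : ∀ {n k} → Decidable (Unique {A = Fin n} {n = k})
unique? = allPairs? λ i j → ¬? (i Fin.≟ j)

-- The symmetric group, in one-line notation.
S : ∀ n → List (Vec (Fin n) n)
S n = filter unique? (tuples n n)

-- φ(α) = σ: after all cars have parked, spot i is occupied by car σᵢ.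
φ[_]≐_ : ∀ {n} → Vec (Fin n) n → Vec (Fin n) n → Set
φ[ α ]≐ σ = outcome α ≡ just (Vec.map just σ)

φ[_]≐?_ : ∀ {n} (α σ : Vec (Fin n) n) → Dec (φ[ α ]≐ σ)
φ[ α ]≐? σ = Maybe.≡-dec (Vec.≡-dec (Maybe.≡-dec Fin._≟_)) (outcome α) (just (Vec.map just σ))

φ⁻¹ : ∀ {n} → Vec (Fin n) n → List (Vec (Fin n) n)
φ⁻¹ {n} σ = filter (φ[_]≐? σ) (PF n)

c : ℕ → ℕ → ℕ
c n i = length (filter (λ σ → length (φ⁻¹ σ) ℕ.≟ i) (S n))

-- The sum over 1 ≤ i ≤ n!, with i = j + 1.
G : ℕ → FormalSum
G n = ∑[ j < n ! ] c n (suc j) · q^ ln (suc j)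

{-# OPTIONS --safe #-}

-- The last car to arrive parks in a spot i that splits σ into σ = λ n ρ, and the
-- cars in λ and ρ never interact.  Any of the i spots up to i will do as its
-- preference, so |φ⁻¹(σ)| = i |φ⁻¹(λ)| |φ⁻¹(ρ)| after standardising λ and ρ, and
-- q^ln turns this product into a product of powers of q.  The binomial
-- coefficient counts the choices of the set of cars that make up λ.

module Submission where

open import Algebra.Properties.CommutativeSemigroup using (x∙yz≈y∙xz)
open import Data.Bool using (if_then_else_; true; false)
open import Data.Fin using (Fin; zero; suc)
import Data.Fin.Properties as Fin
import Data.Integer as ℤ
open import Data.List
  using (List; []; _∷_; [_]; _∷ʳ_; _++_; length; filter; map; concatMap; allFin; foldl; foldr; tabulate; reverse;
         cartesianProductWith)
open import Data.List.Membership.Propositional using (_∈_; _∉_; find; lose)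
import Data.List.Membership.Propositional.Properties as ∈
open import Data.List.Membership.Propositional.Properties.WithK using (unique∧set⇒bag)
import Data.List.Properties as List
open import Data.List.Relation.Binary.BagAndSetEquality using (∼bag⇒↭)
open import Data.List.Relation.Binary.Disjoint.Propositional using (Disjoint)
open import Data.List.Relation.Binary.Permutation.Propositional as Perm using (_↭_)
import Data.List.Relation.Binary.Permutation.Propositional.Properties as Perm
import Data.List.Relation.Binary.Permutation.Setoid.Properties as PermSetoid
import Data.List.Relation.Ternary.Interleaving as Interleaving using (swap)
open import Data.List.Relation.Ternary.Interleaving.Propositional
  using (Interleaving; []; consˡ; consʳ; toPermutation)
open import Data.List.Relation.Ternary.Interleaving.Properties using (interleave-length)
open import Data.List.Relation.Unary.All as All using (All; []; _∷_)
import Data.List.Relation.Unary.All.Properties as All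
open import Data.List.Relation.Unary.AllPairs using ([]; _∷_)
open import Data.List.Relation.Unary.Any using (here; there)
open import Data.List.Relation.Unary.Unique.Propositional using (Unique)
import Data.List.Relation.Unary.Unique.Propositional.Properties as Unique
open import Data.Maybe using (Maybe; just; nothing; _>>=_)
import Data.Maybe as Maybe
import Data.Maybe.Properties as Maybe
import Data.Maybe.Relation.Unary.Any as MaybeAny
open import Data.Nat using (ℕ; zero; suc; _∸_; _≤_; _<_; _+_; _*_; _!; NonZero; s≤s; z≤n)
import Data.Nat as ℕ
open import Data.Nat.Combinatorics using (_C_; nCk+nC[k+1]≡[n+1]C[k+1]; k>n⇒nCk≡0; k![n∸k]!∣n!)
open import Data.Nat.Divisibility using (∣⇒≤)
import Data.Nat.Properties as ℕ
import Data.Nat.Solver as ℕ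
open import Data.Product using (_×_; _,_; ∃; ∃₂; proj₁; proj₂; map₁; map₂)
import Data.Rational.Unnormalised as ℚ
import Data.Rational.Unnormalised.Properties as ℚ
import Data.Rational.Unnormalised.Solver as ℚ
open import Data.Sum using (_⊎_; inj₁; inj₂)
open import Data.Unit using (tt)
open import Data.Vec using (Vec; []; _∷_; toList; lookup; replicate)
import Data.Vec as Vec
import Data.Vec.Properties as Vec
import Data.Vec.Relation.Unary.All.Properties as Vec
import Data.Vec.Relation.Unary.AllPairs as Vec using ([]; _∷_)
import Data.Vec.Relation.Unary.Unique.Propositional as Vec using (Unique)
open import Defs
open import Function using (_∘_; flip; id; mk⇔)
open import Level using (Level)
open import Relation.Binary.Bundles using (Setoid)
open import Relation.Binary.Definitions using (DecidableEquality)
open import Relation.Binary.PropositionalEquality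
  using (_≡_; _≢_; refl; sym; trans; cong; cong₂; subst; setoid; module ≡-Reasoning)
import Relation.Binary.Reasoning.Setoid as SetoidReasoning
open import Relation.Nullary using (Dec; yes; no; contradiction; ¬_; does)
open import Relation.Unary using (Pred; Decidable; _⊆_)

-- Real exponents have no decidable equality, so coefficients of `G n` are never compared. Each
-- generating function is traded for the multiset of fibre sizes, a list of naturals up to
-- permutation; the reals enter only through congruence of addition and `ln-*`. No relabelling takes
-- place either: everything is stated for a duplicate-free list of arbitrary cars, latest first, so
-- the two parts of a permutation keep their car names as sublists, and the multiset of fibre sizes
-- is shown to depend on the length of the list alone. Sublists are not structurally smaller, hence
-- the fuel in `arrangements` and `fibreSizes`. The link to actual parking has to reconcile two
-- directions: cars arrive earliest first, whereas splitting removes the latest first. It rests on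
-- the fact that the final street determines all earlier ones, so the preferences can be counted car
-- by car.

private variable
  ℓ ℓ′ p q : Level
  A : Set ℓ
  B : Set ℓ′
  P : Set p
  Q : Set q

-- The natural logarithm is a homomorphism

+ℝ-congˡ : ∀ {x x′} y → x ≃ℝ x′ → x +ℝ y ≃ℝ x′ +ℝ y
+ℝ-congˡ {x} {x′} y x≃x′ k = begin
  ℚ.∣ (a ℚ.+ b) ℚ.- (a′ ℚ.+ b) ∣
    ≃⟨ ℚ.∣-∣-cong (solve 3 (λ a a′ b → (a :+ b) :- (a′ :+ b) := a :- a′) ℚ.≃-refl a a′ b) ⟩
  ℚ.∣ a ℚ.- a′ ∣             ≤⟨ x≃x′ (2 * k) ⟩
  ℤ.+ 2 ℚ./ (2 * k)          ≤⟨ /-antitone 2 (ℕ.m≤m+n k (k + 0)) ⟩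
  ℤ.+ 2 ℚ./ k                ∎
  where
  open ℚ.≤-Reasoning
  open ℚ.+-*-Solver
  instance _ = ℕ.m*n≢0 2 k
  a = approx x (2 * k)
  a′ = approx x′ (2 * k)
  b = approx y (2 * k)

+ℝ-congʳ : ∀ x {y y′} → y ≃ℝ y′ → x +ℝ y ≃ℝ x +ℝ y′
+ℝ-congʳ x {y} {y′} y≃y′ k = begin
  ℚ.∣ (a ℚ.+ b) ℚ.- (a ℚ.+ b′) ∣
    ≃⟨ ℚ.∣-∣-cong (solve 3 (λ a b b′ → (a :+ b) :- (a :+ b′) := b :- b′) ℚ.≃-refl a b b′) ⟩
  ℚ.∣ b ℚ.- b′ ∣             ≤⟨ y≃y′ (2 * k) ⟩
  ℤ.+ 2 ℚ./ (2 * k)          ≤⟨ /-antitone 2 (ℕ.m≤m+n k (k + 0)) ⟩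
  ℤ.+ 2 ℚ./ k                ∎
  where
  open ℚ.≤-Reasoning
  open ℚ.+-*-Solver
  instance _ = ℕ.m*n≢0 2 k
  a = approx x (2 * k)
  b = approx y (2 * k)
  b′ = approx y′ (2 * k)

-- On a mesh 1/j, the points between a and ab form the a-fold refinement of
-- the Riemann sum for ln b.
lnApprox-* : ∀ a b j .{{_ : NonZero a}} .{{_ : NonZero b}} .{{_ : NonZero j}}
             .{{_ : NonZero (j * a)}} →
             lnApprox (a * b) j ℚ.≃ lnApprox a j ℚ.+ harmonic (j * a) ((b ∸ 1) * j * a)
lnApprox-* (suc a) (suc b) j@(suc _) = ℚ.≃-trans
  (harmonic-cong {j = j} refl split)
  (ℚ.≃-trans (harmonic-++ j (a * j) (b * j * suc a))
    (ℚ.+-congʳ (lnApprox (suc a) j) (harmonic-cong {M = b * j * suc a} (ℕ.*-comm (suc a) j) refl)))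
  where
  split : (suc a * suc b ∸ 1) * j ≡ a * j + b * j * suc a
  split = solve 3 (λ a b j → (b :+ a :* (con 1 :+ b)) :* j := a :* j :+ b :* j :* (con 1 :+ a)) refl a b j
    where open ℕ.+-*-Solver

-- Addition samples its arguments at mesh 1/(2k), so both sides are compared on that mesh. There the
-- sum for ln(ab) splits exactly into `y` and `w`, and `w` refines the sum `z` for ln b, so that w ≤
-- z ≤ w + 1/j with j = 2k. Refining the sum for ln(ab) from mesh 1/k costs at most 1/k, and the
-- total error stays within 2/k.
ln-* : ∀ a b .{{_ : NonZero a}} .{{_ : NonZero b}} .{{_ : NonZero (a * b)}} →
       ln (a * b) ≃ℝ ln a +ℝ ln b
ln-* a b k@(suc _) = ∣-∣-bound x (y ℚ.+ z) (ℤ.+ 2 ℚ./ k)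
  (begin
    x                          ≤⟨ lnApprox-refine-≥ (a * b) k 2 ⟩
    lnApprox (a * b) (k * 2) ℚ.+ ℤ.+ 1 ℚ./ k
      ≃⟨ ℚ.+-congˡ (ℤ.+ 1 ℚ./ k) mid ⟩
    y ℚ.+ w ℚ.+ ℤ.+ 1 ℚ./ k
      ≤⟨ ℚ.+-mono-≤ (ℚ.+-monoʳ-≤ y (harmonic-refine-≤ a j ((b ∸ 1) * j))) (/-mono₁ k) ⟩
    y ℚ.+ z ℚ.+ ℤ.+ 2 ℚ./ k      ∎)
  (begin
    y ℚ.+ z
      ≤⟨ ℚ.+-monoʳ-≤ y z≤w ⟩
    y ℚ.+ (w ℚ.+ ℤ.+ 1 ℚ./ j)
      ≃⟨ ℚ.+-assoc y w (ℤ.+ 1 ℚ./ j) ⟨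
    y ℚ.+ w ℚ.+ ℤ.+ 1 ℚ./ j
      ≃⟨ ℚ.+-congˡ (ℤ.+ 1 ℚ./ j) mid ⟨
    lnApprox (a * b) (k * 2) ℚ.+ ℤ.+ 1 ℚ./ j
      ≤⟨ ℚ.+-mono-≤ (lnApprox-refine-≤ (a * b) k 2) (ℚ.≤-trans (/-antitone 1 (ℕ.m≤m+n k (k + 0))) (/-mono₁ k)) ⟩
    x ℚ.+ ℤ.+ 2 ℚ./ k            ∎)
  where
  open ℚ.≤-Reasoning
  j = 2 * k
  instance
    _ = ℕ.m*n≢0 j a
  x = lnApprox (a * b) k
  y = lnApprox a j
  z = lnApprox b j
  w = harmonic (j * a) ((b ∸ 1) * j * a)
  /-mono₁ : ∀ k .{{_ : NonZero k}} → ℤ.+ 1 ℚ./ k ℚ.≤ ℤ.+ 2 ℚ./ k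
  /-mono₁ k@(suc _) = ℚ.≤-trans (ℚ.p≤p+q (ℤ.+ 1 ℚ./ k) (ℤ.+ 1 ℚ./ k)) (ℚ.≤-reflexive (/-add 1 1 k))
  mid : lnApprox (a * b) (k * 2) ℚ.≃ y ℚ.+ w
  mid = ℚ.≃-trans (harmonic-cong (ℕ.*-comm k 2) (cong ((a * b ∸ 1) *_) (ℕ.*-comm k 2))) (lnApprox-* a b j)
  N = (b ∸ 1) * j
  z≤w : z ℚ.≤ w ℚ.+ ℤ.+ 1 ℚ./ j
  z≤w = begin
    z                            ≤⟨ ℚ.p≤p+q z (ℤ.+ 1 ℚ./ (j + N)) ⟩
    z ℚ.+ ℤ.+ 1 ℚ./ (j + N)      ≤⟨ harmonic-refine-≥ a j N ⟩
    w ℚ.+ ℤ.+ 1 ℚ./ j            ∎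

-- Equality of formal sums is a congruence

≈-setoid : Setoid _ _
≈-setoid = record
  { Carrier       = FormalSum
  ; _≈_           = _≈_
  ; isEquivalence = record { refl = ≈-refl ; sym = ≈-sym ; trans = ≈-trans }
  }

module ≈-Reasoning = SetoidReasoning ≈-setoid

≡⇒≈ : ∀ {f g} → f ≡ g → f ≈ g
≡⇒≈ refl = ≈-refl

↭⇒≈ : ∀ {f g} → f ↭ g → f ≈ g
↭⇒≈ Perm.refl         = ≈-refl
↭⇒≈ (Perm.prep t p)   = prep t (↭⇒≈ p)
↭⇒≈ (Perm.swap s t p) = ≈-trans (swap s t) (prep t (prep s (↭⇒≈ p)))
↭⇒≈ (Perm.trans p q)  = ≈-trans (↭⇒≈ p) (↭⇒≈ q)

⊕-congʳ : ∀ f {g h} → g ≈ h → f ⊕ g ≈ f ⊕ h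
⊕-congʳ []      g≈h = g≈h
⊕-congʳ (t ∷ f) g≈h = prep t (⊕-congʳ f g≈h)

-- Every rule of the presentation acts at the front and leaves a free tail, which absorbs `h`.
⊕-congˡ : ∀ {f g} h → f ≈ g → f ⊕ h ≈ g ⊕ h
⊕-congˡ h ≈-refl            = ≈-refl
⊕-congˡ h (≈-sym p)         = ≈-sym (⊕-congˡ h p)
⊕-congˡ h (≈-trans p q)     = ≈-trans (⊕-congˡ h p) (⊕-congˡ h q)
⊕-congˡ h (prep t p)        = prep t (⊕-congˡ h p)
⊕-congˡ h (swap s t)        = swap s t
⊕-congˡ h (exponent c r≃s)  = exponent c r≃s
⊕-congˡ h (collect c d r)   = collect c d r
⊕-congˡ h (vanish r)        = vanish r

⊕-cong : ∀ {f f′ g g′} → f ≈ f′ → g ≈ g′ → f ⊕ g ≈ f′ ⊕ g′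
⊕-cong {f′ = f′} {g} f≈f′ g≈g′ = ≈-trans (⊕-congˡ g f≈f′) (⊕-congʳ f′ g≈g′)

⊕-interchange : ∀ f g h k → (f ⊕ g) ⊕ (h ⊕ k) ≈ (f ⊕ h) ⊕ (g ⊕ k)
⊕-interchange f g h k = begin
  (f ⊕ g) ⊕ (h ⊕ k)  ≡⟨ List.++-assoc f g (h ⊕ k) ⟩
  f ⊕ (g ⊕ (h ⊕ k))  ≈⟨ ⊕-congʳ f (↭⇒≈ (Perm.shifts g h)) ⟩
  f ⊕ (h ⊕ (g ⊕ k))  ≡⟨ List.++-assoc f h (g ⊕ k) ⟨
  (f ⊕ h) ⊕ (g ⊕ k)  ∎
  where open ≈-Reasoning

·-distribʳ-+ : ∀ c d f → (c + d) · f ≈ c · f ⊕ d · f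
·-distribʳ-+ c d []            = ≈-refl
·-distribʳ-+ c d ((e , r) ∷ f) = begin
  ((c + d) * e , r) ∷ (c + d) · f
    ≡⟨ cong (λ x → (x , r) ∷ (c + d) · f) (ℕ.*-distribʳ-+ e c d) ⟩
  (c * e + d * e , r) ∷ (c + d) · f
    ≈⟨ collect (c * e) (d * e) r ⟨
  (c * e , r) ∷ (d * e , r) ∷ (c + d) · f
    ≈⟨ prep _ (prep _ (·-distribʳ-+ c d f)) ⟩
  (c * e , r) ∷ (d * e , r) ∷ (c · f ⊕ d · f)
    ≈⟨ prep _ (↭⇒≈ (Perm.↭-sym (Perm.shift (d * e , r) (c · f) (d · f)))) ⟩
  (c * e , r) ∷ (c · f ⊕ ((d * e , r) ∷ d · f))  ∎
  where open ≈-Reasoning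

·-zeroˡ : ∀ f → 0 · f ≈ []
·-zeroˡ []            = ≈-refl
·-zeroˡ ((e , r) ∷ f) = ≈-trans (vanish r) (·-zeroˡ f)

·-identityˡ : ∀ f → 1 · f ≈ f
·-identityˡ []            = ≈-refl
·-identityˡ ((e , r) ∷ f) = ≈-trans
  (≡⇒≈ (cong (λ x → (x , r) ∷ 1 · f) (ℕ.*-identityˡ e))) (prep (e , r) (·-identityˡ f))

-- ((c , r) ∷ f) ⊗ g unfolds to the sum of scale c (r +ℝ_) g and f ⊗ g.
scale : ℕ → (ℝ → ℝ) → FormalSum → FormalSum
scale c h = map λ (d , s) → c * d , h s

scale-cong : ∀ c h → (∀ s s′ → s ≃ℝ s′ → h s ≃ℝ h s′) → ∀ {f g} → f ≈ g → scale c h f ≈ scale c h g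
scale-cong c h h-cong ≈-refl                 = ≈-refl
scale-cong c h h-cong (≈-sym p)              = ≈-sym (scale-cong c h h-cong p)
scale-cong c h h-cong (≈-trans p q)          = ≈-trans (scale-cong c h h-cong p) (scale-cong c h h-cong q)
scale-cong c h h-cong (prep t p)             = prep _ (scale-cong c h h-cong p)
scale-cong c h h-cong (swap s t)             = swap _ _
scale-cong c h h-cong (exponent d {s} {s′} s≃s′) = exponent (c * d) {h s} {h s′} (h-cong s s′ s≃s′)
scale-cong c h h-cong (collect d e s {f})    = ≈-trans (collect (c * d) (c * e) (h s))
  (≡⇒≈ (cong (λ x → (x , h s) ∷ scale c h f) (sym (ℕ.*-distribˡ-+ c d e))))
scale-cong c h h-cong (vanish s {f})         = ≈-trans
  (≡⇒≈ (cong (λ x → (x , h s) ∷ scale c h f) (ℕ.*-zeroʳ c))) (vanish (h s))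

scale-exponent : ∀ c h h′ → (∀ s → h s ≃ℝ h′ s) → ∀ f → scale c h f ≈ scale c h′ f
scale-exponent c h h′ h≃h′ []            = ≈-refl
scale-exponent c h h′ h≃h′ ((d , s) ∷ f) =
  ≈-trans (exponent (c * d) {h s} {h′ s} (h≃h′ s)) (prep _ (scale-exponent c h h′ h≃h′ f))

scale-+ : ∀ c d h f → scale c h f ⊕ scale d h f ≈ scale (c + d) h f
scale-+ c d h []            = ≈-refl
scale-+ c d h ((e , s) ∷ f) = begin
  (c * e , h s) ∷ (cf ⊕ ((d * e , h s) ∷ df))
    ≈⟨ prep _ (↭⇒≈ (Perm.shift (d * e , h s) cf df)) ⟩
  (c * e , h s) ∷ (d * e , h s) ∷ (cf ⊕ df)
    ≈⟨ collect (c * e) (d * e) (h s) ⟩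
  (c * e + d * e , h s) ∷ (cf ⊕ df)
    ≡⟨ cong (λ x → (x , h s) ∷ (cf ⊕ df)) (ℕ.*-distribʳ-+ e c d) ⟨
  ((c + d) * e , h s) ∷ (cf ⊕ df)
    ≈⟨ prep _ (scale-+ c d h f) ⟩
  scale (c + d) h ((e , s) ∷ f)  ∎
  where
  open ≈-Reasoning
  cf = scale c h f
  df = scale d h f

scale-zero : ∀ h f → scale 0 h f ≈ []
scale-zero h []            = ≈-refl
scale-zero h ((d , s) ∷ f) = ≈-trans (vanish (h s)) (scale-zero h f)

⊗-congʳ : ∀ f {g h} → g ≈ h → f ⊗ g ≈ f ⊗ h
⊗-congʳ []            g≈h = ≈-refl
⊗-congʳ ((c , r) ∷ f) g≈h =
  ⊕-cong (scale-cong c (r +ℝ_) (λ s s′ → +ℝ-congʳ r {s} {s′}) g≈h) (⊗-congʳ f g≈h)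

-- `_⊗_` recurses on its left factor, so here the induction is on the derivation: each rule about
-- coefficients or exponents becomes a law of `scale`.
⊗-congˡ : ∀ {f g} h → f ≈ g → f ⊗ h ≈ g ⊗ h
⊗-congˡ h ≈-refl                 = ≈-refl
⊗-congˡ h (≈-sym p)              = ≈-sym (⊗-congˡ h p)
⊗-congˡ h (≈-trans p q)          = ≈-trans (⊗-congˡ h p) (⊗-congˡ h q)
⊗-congˡ h (prep (c , r) p)       = ⊕-congʳ (scale c (r +ℝ_) h) (⊗-congˡ h p)
⊗-congˡ h (swap (c , r) (d , s)) = ↭⇒≈ (Perm.shifts (scale c (r +ℝ_) h) (scale d (s +ℝ_) h))
⊗-congˡ h (exponent c {r} {s} {f} r≃s) =
  ⊕-congˡ (f ⊗ h) (scale-exponent c (r +ℝ_) (s +ℝ_) (λ t → +ℝ-congˡ {r} {s} t r≃s) h)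
⊗-congˡ h (collect c d r {f}) = ≈-trans
  (≡⇒≈ (sym (List.++-assoc (scale c (r +ℝ_) h) (scale d (r +ℝ_) h) (f ⊗ h))))
  (⊕-congˡ (f ⊗ h) (scale-+ c d (r +ℝ_) h))
⊗-congˡ h (vanish r {f}) = ⊕-congˡ (f ⊗ h) (scale-zero (r +ℝ_) h)

⊗-cong : ∀ {f f′ g g′} → f ≈ f′ → g ≈ g′ → f ⊗ g ≈ f′ ⊗ g′
⊗-cong {f′ = f′} {g} f≈f′ g≈g′ = ≈-trans (⊗-congˡ g f≈f′) (⊗-congʳ f′ g≈g′)

⊗-zeroʳ : ∀ f → f ⊗ [] ≡ []
⊗-zeroʳ = List.cartesianProductWith-zeroʳ _

⊗-distribʳ-⊕ : ∀ f g h → (f ⊕ g) ⊗ h ≡ f ⊗ h ⊕ g ⊗ h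
⊗-distribʳ-⊕ = List.cartesianProductWith-distribʳ-++ _

⊗-distribˡ-⊕ : ∀ f g h → f ⊗ (g ⊕ h) ≈ f ⊗ g ⊕ f ⊗ h
⊗-distribˡ-⊕ []            g h = ≈-refl
⊗-distribˡ-⊕ ((c , r) ∷ f) g h = begin
  scale c (r +ℝ_) (g ⊕ h) ⊕ f ⊗ (g ⊕ h)
    ≈⟨ ⊕-cong (≡⇒≈ (List.map-++ _ g h)) (⊗-distribˡ-⊕ f g h) ⟩
  (scale c (r +ℝ_) g ⊕ scale c (r +ℝ_) h) ⊕ (f ⊗ g ⊕ f ⊗ h)
    ≈⟨ ⊕-interchange (scale c (r +ℝ_) g) (scale c (r +ℝ_) h) (f ⊗ g) (f ⊗ h) ⟩
  (scale c (r +ℝ_) g ⊕ f ⊗ g) ⊕ (scale c (r +ℝ_) h ⊕ f ⊗ h)  ∎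
  where open ≈-Reasoning

-- Finite sums

∑-suc : ∀ n f → ∑ (suc n) f ≡ f 0 ⊕ ∑ n (f ∘ suc)
∑-suc n f = cong (λ ts → f 0 ⊕ foldr _⊕_ [] ts)
  (trans (List.map-applyUpTo suc f n) (sym (List.map-upTo (f ∘ suc) n)))

∑-cong : ∀ n {f g : ℕ → FormalSum} → (∀ i → f i ≈ g i) → ∑ n f ≈ ∑ n g
∑-cong zero    f≈g = ≈-refl
∑-cong (suc n) {f} {g} f≈g = begin
  ∑ (suc n) f            ≡⟨ ∑-suc n f ⟩
  f 0 ⊕ ∑ n (f ∘ suc)    ≈⟨ ⊕-cong (f≈g 0) (∑-cong n (f≈g ∘ suc)) ⟩
  g 0 ⊕ ∑ n (g ∘ suc)    ≡⟨ ∑-suc n g ⟨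
  ∑ (suc n) g            ∎
  where open ≈-Reasoning

∑-⊕ : ∀ n f g → ∑ n (λ i → f i ⊕ g i) ≈ ∑ n f ⊕ ∑ n g
∑-⊕ zero    f g = ≈-refl
∑-⊕ (suc n) f g = begin
  ∑ (suc n) (λ i → f i ⊕ g i)
    ≡⟨ ∑-suc n (λ i → f i ⊕ g i) ⟩
  (f 0 ⊕ g 0) ⊕ ∑ n (λ i → f (suc i) ⊕ g (suc i))
    ≈⟨ ⊕-congʳ (f 0 ⊕ g 0) (∑-⊕ n (f ∘ suc) (g ∘ suc)) ⟩
  (f 0 ⊕ g 0) ⊕ (∑ n (f ∘ suc) ⊕ ∑ n (g ∘ suc))
    ≈⟨ ⊕-interchange (f 0) (g 0) (∑ n (f ∘ suc)) (∑ n (g ∘ suc)) ⟩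
  (f 0 ⊕ ∑ n (f ∘ suc)) ⊕ (g 0 ⊕ ∑ n (g ∘ suc))
    ≡⟨ cong₂ _⊕_ (∑-suc n f) (∑-suc n g) ⟨
  ∑ (suc n) f ⊕ ∑ (suc n) g  ∎
  where open ≈-Reasoning

∑-last : ∀ n f → ∑ (suc n) f ≡ ∑ n f ⊕ f n
∑-last zero    f = List.++-identityʳ (f 0)
∑-last (suc n) f = begin
  ∑ (suc (suc n)) f                  ≡⟨ ∑-suc (suc n) f ⟩
  f 0 ⊕ ∑ (suc n) (f ∘ suc)          ≡⟨ cong (f 0 ⊕_) (∑-last n (f ∘ suc)) ⟩
  f 0 ⊕ (∑ n (f ∘ suc) ⊕ f (suc n))  ≡⟨ List.++-assoc (f 0) (∑ n (f ∘ suc)) (f (suc n)) ⟨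
  f 0 ⊕ ∑ n (f ∘ suc) ⊕ f (suc n)    ≡⟨ cong (_⊕ f (suc n)) (∑-suc n f) ⟨
  ∑ (suc n) f ⊕ f (suc n)            ∎
  where open ≡-Reasoning

∑-vanish : ∀ n {f : ℕ → FormalSum} → (∀ i → f i ≈ []) → ∑ n f ≈ []
∑-vanish zero    f≈0 = ≈-refl
∑-vanish (suc n) {f} f≈0 = ≈-trans (≡⇒≈ (∑-suc n f)) (⊕-cong (f≈0 0) (∑-vanish n (f≈0 ∘ suc)))

-- The sizes of the subsets of an n-element set, each with multiplicity.
subsetSizes : ℕ → List ℕ
subsetSizes zero    = 0 ∷ []
subsetSizes (suc n) = map suc (subsetSizes n) ++ subsetSizes n

subsetSizes≤ : ∀ n → All (_≤ n) (subsetSizes n)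
subsetSizes≤ zero    = z≤n ∷ []
subsetSizes≤ (suc n) = All.++⁺ (All.map⁺ (All.map s≤s (subsetSizes≤ n))) (All.map ℕ.m≤n⇒m≤1+n (subsetSizes≤ n))

-- Pascal's rule: the subsets with and without a chosen element give its two terms.
concatMap-subsetSizes : ∀ n (f : ℕ → FormalSum) →
                        concatMap f (subsetSizes n) ≈ ∑[ i < suc n ] (n C i) · f i
concatMap-subsetSizes zero    f = ≈-sym (⊕-congˡ [] (·-identityˡ (f 0)))
concatMap-subsetSizes (suc n) f = begin
  concatMap f (map suc (subsetSizes n) ++ subsetSizes n)
    ≡⟨ List.concatMap-++ f (map suc (subsetSizes n)) (subsetSizes n) ⟩
  concatMap f (map suc (subsetSizes n)) ⊕ concatMap f (subsetSizes n)
    ≡⟨ cong (_⊕ concatMap f (subsetSizes n)) (List.concatMap-map f suc (subsetSizes n)) ⟩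
  concatMap (f ∘ suc) (subsetSizes n) ⊕ concatMap f (subsetSizes n)
    ≈⟨ ⊕-cong (concatMap-subsetSizes n (f ∘ suc)) (concatMap-subsetSizes n f) ⟩
  lower ⊕ (∑[ i < suc n ] (n C i) · f i)
    ≈⟨ ⊕-congʳ lower extend ⟩
  lower ⊕ (∑[ i < suc (suc n) ] (n C i) · f i)
    ≡⟨ cong (lower ⊕_) (∑-suc (suc n) (λ i → (n C i) · f i)) ⟩
  lower ⊕ (1 · f 0 ⊕ upper)
    ≈⟨ ↭⇒≈ (Perm.shifts lower (1 · f 0)) ⟩
  1 · f 0 ⊕ (lower ⊕ upper)
    ≈⟨ ⊕-congʳ (1 · f 0) (∑-⊕ (suc n) (λ i → (n C i) · f (suc i)) (λ i → (n C suc i) · f (suc i))) ⟨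
  1 · f 0 ⊕ (∑[ i < suc n ] (n C i) · f (suc i) ⊕ (n C suc i) · f (suc i))
    ≈⟨ ⊕-congʳ (1 · f 0) (∑-cong (suc n) pascal) ⟩
  1 · f 0 ⊕ (∑[ i < suc n ] (suc n C suc i) · f (suc i))
    ≡⟨ ∑-suc (suc n) (λ i → (suc n C i) · f i) ⟨
  ∑[ i < suc (suc n) ] (suc n C i) · f i  ∎
  where
  open ≈-Reasoning
  lower = ∑[ i < suc n ] (n C i) · f (suc i)
  upper = ∑[ i < suc n ] (n C suc i) · f (suc i)
  -- A vanishing top term, n choose n+1, gives this sum the length at which splitting off i = 0
  -- aligns the rest with `lower`.
  extend : ∑[ i < suc n ] (n C i) · f i ≈ ∑[ i < suc (suc n) ] (n C i) · f i
  extend = begin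
    ∑[ i < suc n ] (n C i) · f i
      ≡⟨ List.++-identityʳ _ ⟨
    (∑[ i < suc n ] (n C i) · f i) ⊕ []
      ≈⟨ ⊕-congʳ _ (·-zeroˡ (f (suc n))) ⟨
    (∑[ i < suc n ] (n C i) · f i) ⊕ 0 · f (suc n)
      ≡⟨ cong (λ x → (∑[ i < suc n ] (n C i) · f i) ⊕ x · f (suc n)) (k>n⇒nCk≡0 {n} (ℕ.n<1+n n)) ⟨
    (∑[ i < suc n ] (n C i) · f i) ⊕ (n C suc n) · f (suc n)
      ≡⟨ ∑-last (suc n) (λ i → (n C i) · f i) ⟨
    ∑[ i < suc (suc n) ] (n C i) · f i  ∎
  pascal : ∀ i → (n C i) · f (suc i) ⊕ (n C suc i) · f (suc i) ≈ (suc n C suc i) · f (suc i)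
  pascal i = ≈-trans (≈-sym (·-distribʳ-+ (n C i) (n C suc i) (f (suc i))))
    (≡⇒≈ (cong (_· f (suc i)) (nCk+nC[k+1]≡[n+1]C[k+1] n i)))

-- With the convention q^ln 0 = 0, q^ln is multiplicative on all of ℕ.
infix 9 q^ln_

q^ln_ : ℕ → FormalSum
q^ln zero    = []
q^ln (suc a) = q^ ln (suc a)

q^ln-* : ∀ a b → q^ln (a * b) ≈ q^ln a ⊗ q^ln b
q^ln-* zero    b       = ≈-refl
q^ln-* (suc a) zero    = ≡⇒≈ (cong q^ln_ (ℕ.*-zeroʳ a))
q^ln-* (suc a) (suc b) = exponent 1 (ln-* (suc a) (suc b))

∑q^ln : List ℕ → FormalSum
∑q^ln = concatMap q^ln_

∑q^ln-resp-↭ : ∀ {as bs} → as ↭ bs → ∑q^ln as ≈ ∑q^ln bs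
∑q^ln-resp-↭ Perm.refl         = ≈-refl
∑q^ln-resp-↭ (Perm.prep a p)   = ⊕-congʳ (q^ln a) (∑q^ln-resp-↭ p)
∑q^ln-resp-↭ (Perm.swap a b p) = ≈-trans (↭⇒≈ (Perm.shifts (q^ln a) (q^ln b)))
  (⊕-congʳ (q^ln b) (⊕-congʳ (q^ln a) (∑q^ln-resp-↭ p)))
∑q^ln-resp-↭ (Perm.trans p q)  = ≈-trans (∑q^ln-resp-↭ p) (∑q^ln-resp-↭ q)

products : List ℕ → List ℕ → List ℕ
products as bs = concatMap (λ a → map (a *_) bs) as

∑q^ln-scale : ∀ a bs → ∑q^ln (map (a *_) bs) ≈ q^ln a ⊗ ∑q^ln bs
∑q^ln-scale a []       = ≡⇒≈ (sym (⊗-zeroʳ (q^ln a)))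
∑q^ln-scale a (b ∷ bs) = ≈-trans (⊕-cong (q^ln-* a b) (∑q^ln-scale a bs))
  (≈-sym (⊗-distribˡ-⊕ (q^ln a) (q^ln b) (∑q^ln bs)))

∑q^ln-products : ∀ as bs → ∑q^ln (products as bs) ≈ ∑q^ln as ⊗ ∑q^ln bs
∑q^ln-products []       bs = ≈-refl
∑q^ln-products (a ∷ as) bs = begin
  ∑q^ln (map (a *_) bs ++ products as bs)
    ≡⟨ List.concatMap-++ q^ln_ (map (a *_) bs) (products as bs) ⟩
  ∑q^ln (map (a *_) bs) ⊕ ∑q^ln (products as bs)
    ≈⟨ ⊕-cong (∑q^ln-scale a bs) (∑q^ln-products as bs) ⟩
  q^ln a ⊗ ∑q^ln bs ⊕ ∑q^ln as ⊗ ∑q^ln bs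
    ≡⟨ ⊗-distribʳ-⊕ (q^ln a) (∑q^ln as) (∑q^ln bs) ⟨
  (q^ln a ⊕ ∑q^ln as) ⊗ ∑q^ln bs  ∎
  where open ≈-Reasoning

∑q^ln-concatMap : ∀ (f : A → List ℕ) xs → ∑q^ln (concatMap f xs) ≡ concatMap (∑q^ln ∘ f) xs
∑q^ln-concatMap f []       = refl
∑q^ln-concatMap f (x ∷ xs) = trans (List.concatMap-++ q^ln_ (f x) (concatMap f xs))
  (cong (∑q^ln (f x) ⊕_) (∑q^ln-concatMap f xs))

-- Collecting equal powers of q
multiplicity : (A → ℕ) → List A → ℕ → ℕ
multiplicity w xs i = length (filter (λ x → w x ℕ.≟ i) xs)

indicator : ℕ → ℕ → ℕ
indicator a i = multiplicity (λ x → x) [ a ] i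

multiplicity-∷ : ∀ (w : A → ℕ) x xs i →
                 multiplicity w (x ∷ xs) i ≡ indicator (w x) i + multiplicity w xs i
-- `does (w x ℕ.≟ i)` reduces to this test, which decides both filters at once.
multiplicity-∷ w x xs i with w x ℕ.≡ᵇ i
... | true  = refl
... | false = refl

indicator-refl : ∀ a → indicator a a ≡ 1
indicator-refl a = cong length (List.filter-accept (ℕ._≟ a) {xs = []} refl)

indicator-≢ : ∀ {a i} → a ≢ i → indicator a i ≡ 0
indicator-≢ {i = i} a≢i = cong length (List.filter-reject (ℕ._≟ i) {xs = []} a≢i)

∑-multiplicity : (A → ℕ) → List A → ℕ → FormalSum
∑-multiplicity w xs n = ∑[ j < n ] multiplicity w xs (suc j) · q^ ln (suc j)

∑-indicator : ℕ → ℕ → FormalSum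
∑-indicator a = ∑-multiplicity (λ x → x) [ a ]

∑-indicator-last : ∀ a n → a ≢ suc n → ∑-indicator a (suc n) ≈ ∑-indicator a n
∑-indicator-last a n a≢1+n = begin
  ∑-indicator a (suc n)
    ≡⟨ ∑-last n (λ j → indicator a (suc j) · q^ ln (suc j)) ⟩
  ∑-indicator a n ⊕ indicator a (suc n) · q^ ln (suc n)
    ≡⟨ cong (λ x → ∑-indicator a n ⊕ x · q^ ln (suc n)) (indicator-≢ a≢1+n) ⟩
  ∑-indicator a n ⊕ 0 · q^ ln (suc n)
    ≈⟨ ⊕-congʳ (∑-indicator a n) (·-zeroˡ (q^ ln (suc n))) ⟩
  ∑-indicator a n ⊕ []
    ≡⟨ List.++-identityʳ (∑-indicator a n) ⟩
  ∑-indicator a n  ∎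
  where open ≈-Reasoning

∑-indicator-> : ∀ {a} n → n < a → ∑-indicator a n ≈ []
∑-indicator-> zero    n<a = ≈-refl
∑-indicator-> (suc n) n<a = ≈-trans (∑-indicator-last _ n (ℕ.>⇒≢ n<a)) (∑-indicator-> n (ℕ.<⇒≤ n<a))

-- Top summands are removed until n reaches a; below that, `∑-indicator->` leaves nothing. For a = 0
-- all summands vanish, in accord with `q^ln 0`.
∑-indicator-≤ : ∀ {a} n → a ≤ n → ∑-indicator a n ≈ q^ln a
∑-indicator-≤ {zero} zero    z≤n = ≈-refl
∑-indicator-≤ {a}    (suc n) a≤1+n with ℕ.m≤n⇒m<n∨m≡n a≤1+n
... | inj₁ a<1+n = ≈-trans (∑-indicator-last a n (ℕ.<⇒≢ a<1+n)) (∑-indicator-≤ n (ℕ.≤-pred a<1+n))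
... | inj₂ refl  = begin
  ∑-indicator (suc n) (suc n)
    ≡⟨ ∑-last n (λ j → indicator (suc n) (suc j) · q^ ln (suc j)) ⟩
  ∑-indicator (suc n) n ⊕ indicator (suc n) (suc n) · q^ ln (suc n)
    ≈⟨ ⊕-cong (∑-indicator-> n ℕ.≤-refl) (≡⇒≈ (cong (_· q^ ln (suc n)) (indicator-refl (suc n)))) ⟩
  q^ ln (suc n)  ∎
  where open ≈-Reasoning

-- The bound keeps every weight inside the range of the sum. Each entry then contributes its own
-- `∑-indicator`: a single power of q, or nothing if its weight is 0.
∑-multiplicity-≤ : ∀ (w : A → ℕ) n {xs} → All (λ x → w x ≤ n) xs →
                   ∑-multiplicity w xs n ≈ ∑q^ln (map w xs)
∑-multiplicity-≤ w n []                      = ∑-vanish n (λ j → ·-zeroˡ (q^ ln (suc j)))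
∑-multiplicity-≤ w n {x ∷ xs} (wx≤n ∷ wxs≤n) = begin
  ∑-multiplicity w (x ∷ xs) n
    ≈⟨ ∑-cong n (λ j → ≈-trans
         (≡⇒≈ (cong (_· q^ ln (suc j)) (multiplicity-∷ w x xs (suc j))))
         (·-distribʳ-+ (indicator (w x) (suc j)) (multiplicity w xs (suc j)) (q^ ln (suc j)))) ⟩
  ∑[ j < n ] indicator (w x) (suc j) · q^ ln (suc j) ⊕ multiplicity w xs (suc j) · q^ ln (suc j)
    ≈⟨ ∑-⊕ n (λ j → indicator (w x) (suc j) · q^ ln (suc j)) (λ j → multiplicity w xs (suc j) · q^ ln (suc j)) ⟩
  ∑-indicator (w x) n ⊕ ∑-multiplicity w xs n
    ≈⟨ ⊕-cong (∑-indicator-≤ n wx≤n) (∑-multiplicity-≤ w n wxs≤n) ⟩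
  ∑q^ln (map w (x ∷ xs))  ∎
  where open ≈-Reasoning

G≈∑q^ln : ∀ n → All (λ σ → length (φ⁻¹ σ) ≤ n !) (S n) → G n ≈ ∑q^ln (map (length ∘ φ⁻¹) (S n))
G≈∑q^ln n = ∑-multiplicity-≤ (length ∘ φ⁻¹) (n !)

-- Lists without repetition

∈-concatMap⁺ : ∀ (f : A → List B) {x y xs} → x ∈ xs → y ∈ f x → y ∈ concatMap f xs
∈-concatMap⁺ f x∈xs y∈fx = ∈.∈-concatMap⁺ f (lose x∈xs y∈fx)

∈-concatMap⁻ : ∀ (f : A → List B) {y} xs → y ∈ concatMap f xs → ∃ λ x → x ∈ xs × y ∈ f x
∈-concatMap⁻ f xs y∈ = find (∈.∈-concatMap⁻ f {xs = xs} y∈)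

concatMap-unique : ∀ (f : A → List B) {xs} → Unique xs →
                   (∀ {x} → x ∈ xs → Unique (f x)) →
                   (∀ {x x′ y} → x ∈ xs → x′ ∈ xs → y ∈ f x → y ∈ f x′ → x ≡ x′) →
                   Unique (concatMap f xs)
concatMap-unique f []                        fx! determined = []
concatMap-unique f {x ∷ xs} x∷xs!@(_ ∷ xs!) fx! determined = Unique.++⁺
  (fx! (here refl))
  (concatMap-unique f xs! (fx! ∘ there) (λ p q → determined (there p) (there q)))
  λ (y∈fx , y∈fxs) → let x′ , x′∈xs , y∈fx′ = ∈-concatMap⁻ f xs y∈fxs in
    Unique.Unique[x∷xs]⇒x∉xs x∷xs!
      (subst (_∈ xs) (sym (determined (here refl) (there x′∈xs) y∈fx y∈fx′)) x′∈xs)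

concatMap-cong-local : ∀ {f g : A → List B} {xs} → (∀ {x} → x ∈ xs → f x ≡ g x) →
                       concatMap f xs ≡ concatMap g xs
concatMap-cong-local {xs = []}     f≡g = refl
concatMap-cong-local {xs = x ∷ xs} f≡g = cong₂ _++_ (f≡g (here refl)) (concatMap-cong-local (f≡g ∘ there))

unique∧set⇒↭ : {xs ys : List A} → Unique xs → Unique ys →
               (∀ {x} → x ∈ xs → x ∈ ys) → (∀ {x} → x ∈ ys → x ∈ xs) → xs ↭ ys
unique∧set⇒↭ xs! ys! xs⊆ys ys⊆xs = ∼bag⇒↭ (unique∧set⇒bag xs! ys! (mk⇔ xs⊆ys ys⊆xs))

Unique-resp-↭ : {xs ys : List A} → xs ↭ ys → Unique xs → Unique ys
Unique-resp-↭ {A = A} p = PermSetoid.Unique-resp-↭ (setoid A) (Perm.↭⇒↭ₛ p)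

-- As x occurs in neither prefix, its first occurrence marks the same cut in both.
++-∷-injective : ∀ {x : A} l {r l′ r′} → x ∉ l → x ∉ l′ →
                 l ++ x ∷ r ≡ l′ ++ x ∷ r′ → l ≡ l′ × r ≡ r′
++-∷-injective []      {l′ = []}      x∉l x∉l′ eq = refl , List.∷-injectiveʳ eq
++-∷-injective []      {l′ = y ∷ l′}  x∉l x∉l′ eq = contradiction (here (List.∷-injectiveˡ eq)) x∉l′
++-∷-injective (y ∷ l) {l′ = []}      x∉l x∉l′ eq = contradiction (here (sym (List.∷-injectiveˡ eq))) x∉l
++-∷-injective (y ∷ l) {l′ = y′ ∷ l′} x∉l x∉l′ eq =
  let l≡l′ , r≡r′ = ++-∷-injective l (x∉l ∘ there) (x∉l′ ∘ there) (List.∷-injectiveʳ eq)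
  in cong₂ _∷_ (List.∷-injectiveˡ eq) l≡l′ , r≡r′

-- Splitting a list into two complementary sublists

splits : List A → List (List A × List A)
splits []       = [ [] , [] ]
splits (x ∷ xs) = map (map₁ (x ∷_)) (splits xs) ++ map (map₂ (x ∷_)) (splits xs)

∈-splits⁺ : ∀ {l r xs : List A} → Interleaving l r xs → (l , r) ∈ splits xs
∈-splits⁺ []        = here refl
∈-splits⁺ (consˡ i) = ∈.∈-++⁺ˡ (∈.∈-map⁺ _ (∈-splits⁺ i))
∈-splits⁺ (consʳ i) = ∈.∈-++⁺ʳ _ (∈.∈-map⁺ _ (∈-splits⁺ i))

∈-splits⁻ : ∀ {l r} (xs : List A) → (l , r) ∈ splits xs → Interleaving l r xs
∈-splits⁻ []       (here refl) = []
∈-splits⁻ (x ∷ xs) p with ∈.∈-++⁻ (map (map₁ (x ∷_)) (splits xs)) p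
... | inj₁ q with _ , lr∈ , refl ← ∈.∈-map⁻ _ q = consˡ (∈-splits⁻ xs lr∈)
... | inj₂ q with _ , lr∈ , refl ← ∈.∈-map⁻ _ q = consʳ (∈-splits⁻ xs lr∈)

Interleaving-⊆ˡ : ∀ {l r xs : List A} {x} → Interleaving l r xs → x ∈ l → x ∈ xs
Interleaving-⊆ˡ i x∈l = Perm.∈-resp-↭ (Perm.↭-sym (toPermutation i)) (∈.∈-++⁺ˡ x∈l)

Interleaving-⊆ʳ : ∀ {l r xs : List A} {x} → Interleaving l r xs → x ∈ r → x ∈ xs
Interleaving-⊆ʳ {l = l} i x∈r = Perm.∈-resp-↭ (Perm.↭-sym (toPermutation i)) (∈.∈-++⁺ʳ l x∈r)

Interleaving-unique : ∀ {l r xs : List A} → Interleaving l r xs → Unique xs →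
                      Unique l × Unique r × Disjoint l r
Interleaving-unique {l = l} i xs! = Unique-++⁻ l (Unique-resp-↭ (toPermutation i) xs!)
  where
  Unique-++⁻ : ∀ (l : List A) {r} → Unique (l ++ r) → Unique l × Unique r × Disjoint l r
  Unique-++⁻ []      r! = [] , r! , λ ()
  Unique-++⁻ (x ∷ l) x∷lr!@(_ ∷ lr!) =
    let l! , r! , l#r = Unique-++⁻ l lr! ; x∉lr = Unique.Unique[x∷xs]⇒x∉xs x∷lr! in
    All.++⁻ˡ l (All.¬Any⇒All¬ _ x∉lr) ∷ l! , r! ,
    λ { (here refl , x∈r) → x∉lr (∈.∈-++⁺ʳ l x∈r) ; (there x∈l , x∈r) → l#r (x∈l , x∈r) }

-- A sublist of a duplicate-free list inherits its order, so its set of entries determines it. This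
-- lets `arrangements-unique` recover the split from the rearranged halves.
Interleaving-determined : ∀ {l r l′ r′ xs : List A} → Unique xs →
  Interleaving l r xs → Interleaving l′ r′ xs → l ↭ l′ → r ↭ r′ → (l , r) ≡ (l′ , r′)
Interleaving-determined xs! []        []        p q = refl
Interleaving-determined (_ ∷ xs!) (consˡ i) (consˡ j) p q =
  cong (map₁ (_ ∷_)) (Interleaving-determined xs! i j (Perm.drop-∷ p) q)
Interleaving-determined xs! (consˡ i) (consʳ j) p q =
  contradiction (Interleaving-⊆ˡ j (Perm.∈-resp-↭ p (here refl))) (Unique.Unique[x∷xs]⇒x∉xs xs!)
Interleaving-determined xs! (consʳ i) (consˡ j) p q =
  contradiction (Interleaving-⊆ʳ j (Perm.∈-resp-↭ q (here refl))) (Unique.Unique[x∷xs]⇒x∉xs xs!)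
Interleaving-determined (_ ∷ xs!) (consʳ i) (consʳ j) p q =
  cong (map₂ (_ ∷_)) (Interleaving-determined xs! i j p (Perm.drop-∷ q))

splits-unique : {xs : List A} → Unique xs → Unique (splits xs)
splits-unique []                        = [] ∷ []
splits-unique {xs = x ∷ xs} x∷xs!@(_ ∷ xs!) = Unique.++⁺
  (Unique.map⁺ (λ { refl → refl }) (splits-unique xs!))
  (Unique.map⁺ (λ { refl → refl }) (splits-unique xs!))
  disjoint
  where
  disjoint : Disjoint (map (map₁ (x ∷_)) (splits xs)) (map (map₂ (x ∷_)) (splits xs))
  disjoint (p , q) with ∈.∈-map⁻ _ p | ∈.∈-map⁻ _ q
  ... | (l , r) , _ , refl | (_ , r′) , lr∈ , refl =
    Unique.Unique[x∷xs]⇒x∉xs x∷xs! (Interleaving-⊆ˡ (∈-splits⁻ xs lr∈) (here refl))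

-- Both halves are put back into the order of `xs`: the head of `xs` moves to the front of a half
-- that contains it. This recovers a split from which a given permutation arises.
↭⇒Interleaving : ∀ l r (xs : List A) → l ++ r ↭ xs →
                 ∃₂ λ l′ r′ → Interleaving l′ r′ xs × l ↭ l′ × r ↭ r′
↭⇒Interleaving l r [] p
  with List.++-conicalˡ l r (Perm.↭-empty-inv p) | List.++-conicalʳ l r (Perm.↭-empty-inv p)
... | refl | refl = [] , [] , [] , Perm.refl , Perm.refl
↭⇒Interleaving l r (x ∷ xs) p with ∈.∈-++⁻ l (Perm.∈-resp-↭ (Perm.↭-sym p) (here refl))
... | inj₁ x∈l with l₁ , l₂ , refl ← ∈.∈-∃++ x∈l =
  let l′ , r′ , i , l↭l′ , r↭r′ = ↭⇒Interleaving (l₁ ++ l₂) r xs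
        (subst (_↭ xs) (sym (List.++-assoc l₁ l₂ r))
          (Perm.drop-mid l₁ [] (subst (_↭ x ∷ xs) (List.++-assoc l₁ (x ∷ l₂) r) p)))
  in x ∷ l′ , r′ , consˡ i , Perm.trans (Perm.shift x l₁ l₂) (Perm.prep x l↭l′) , r↭r′
... | inj₂ x∈r with r₁ , r₂ , refl ← ∈.∈-∃++ x∈r =
  let l′ , r′ , i , l↭l′ , r↭r′ = ↭⇒Interleaving l (r₁ ++ r₂) xs
        (subst (_↭ xs) (List.++-assoc l r₁ r₂)
          (Perm.drop-mid (l ++ r₁) [] (subst (_↭ x ∷ xs) (sym (List.++-assoc l r₁ (x ∷ r₂))) p)))
  in l′ , x ∷ r′ , consʳ i , l↭l′ , Perm.trans (Perm.shift x r₁ r₂) (Perm.prep x r↭r′)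

splits-sizes : ∀ (xs : List A) → map (length ∘ proj₁) (splits xs) ≡ subsetSizes (length xs)
splits-sizes []       = refl
splits-sizes (x ∷ xs) = trans (List.map-++ _ (map (map₁ (x ∷_)) (splits xs)) _) (cong₂ _++_
  (trans (sym (List.map-∘ (splits xs))) (trans (List.map-∘ (splits xs)) (cong (map suc) (splits-sizes xs))))
  (trans (sym (List.map-∘ (splits xs))) (splits-sizes xs)))

length-splitʳ : ∀ {l r xs : List A} → Interleaving l r xs → length r ≡ length xs ∸ length l
length-splitʳ {l = l} {r} i =
  trans (sym (ℕ.m+n∸m≡n (length l) (length r))) (cong (_∸ length l) (sym (interleave-length i)))

-- The permutations of a list with at most `fuel` entries.  Its first entry plays
-- the last car to arrive, whose spot splits the street into two smaller ones.
arrangements : (fuel : ℕ) → List A → List (List A)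
arrangements _          []       = [ [] ]
arrangements zero       (_ ∷ _)  = []
arrangements (suc fuel) (x ∷ xs) = concatMap around (splits xs)
  module Around where
  around : List _ × List _ → List (List _)
  around (l , r) = concatMap (λ l′ → map (λ r′ → l′ ++ x ∷ r′) (arrangements fuel r)) (arrangements fuel l)

∈-around⁻ : ∀ fuel (x : A) xs l r {z} → z ∈ Around.around fuel x xs (l , r) →
            ∃₂ λ l′ r′ → l′ ∈ arrangements fuel l × r′ ∈ arrangements fuel r × z ≡ l′ ++ x ∷ r′
∈-around⁻ fuel x xs l r z∈ with ∈-concatMap⁻ _ (arrangements fuel l) z∈
... | l′ , l′∈ , z∈′ with ∈.∈-map⁻ _ z∈′
...   | r′ , r′∈ , refl = l′ , r′ , l′∈ , r′∈ , refl

∈-arrangements⁻ : ∀ fuel (xs : List A) {z} → z ∈ arrangements fuel xs → z ↭ xs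
∈-arrangements⁻ fuel       []       (here refl) = Perm.refl
∈-arrangements⁻ (suc fuel) (x ∷ xs) z∈ with ∈-concatMap⁻ _ (splits xs) z∈
... | (l , r) , lr∈ , z∈′ with ∈-around⁻ fuel x xs l r z∈′
...   | l′ , r′ , l′∈ , r′∈ , refl = Perm.trans (Perm.shift x l′ r′) (Perm.prep x (Perm.trans
  (Perm.++⁺ (∈-arrangements⁻ fuel l l′∈) (∈-arrangements⁻ fuel r r′∈))
  (Perm.↭-sym (toPermutation (∈-splits⁻ xs lr∈)))))

length-splitˡ≤ : ∀ {l r xs : List A} {n} → Interleaving l r xs → length xs ≤ n → length l ≤ n
length-splitˡ≤ i xs≤n = ℕ.≤-trans (subst (_ ≤_) (sym (interleave-length i)) (ℕ.m≤m+n _ _)) xs≤n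

length-splitʳ≤ : ∀ {l r xs : List A} {n} → Interleaving l r xs → length xs ≤ n → length r ≤ n
length-splitʳ≤ i xs≤n = ℕ.≤-trans (subst (_ ≤_) (sym (interleave-length i)) (ℕ.m≤n+m _ _)) xs≤n

∈-arrangements⁺ : ∀ fuel (xs : List A) {z} → length xs ≤ fuel → z ↭ xs → z ∈ arrangements fuel xs
∈-arrangements⁺ fuel       []       len p with refl ← Perm.↭-empty-inv p = here refl
∈-arrangements⁺ (suc fuel) (x ∷ xs) (s≤s len) p with ∈.∈-∃++ (Perm.∈-resp-↭ (Perm.↭-sym p) (here refl))
... | l′ , r′ , refl =
  let l , r , i , l′↭l , r′↭r = ↭⇒Interleaving l′ r′ xs (Perm.drop-mid l′ [] p)
  in ∈-concatMap⁺ (Around.around fuel x xs) (∈-splits⁺ i)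
       (∈-concatMap⁺ _ (∈-arrangements⁺ fuel l (length-splitˡ≤ i len) l′↭l)
         (∈.∈-map⁺ _ (∈-arrangements⁺ fuel r (length-splitʳ≤ i len) r′↭r)))

-- A member l′ ++ x ∷ r′ can be cut only at x, which yields l′ and r′; these are rearrangements of l
-- and r and so determine the split.
arrangements-unique : ∀ fuel {xs : List A} → Unique xs → Unique (arrangements fuel xs)
arrangements-unique fuel       []                          = [] ∷ []
arrangements-unique zero       (_ ∷ _)                     = []
arrangements-unique (suc fuel) {x ∷ xs} x∷xs!@(_ ∷ xs!) =
  concatMap-unique (Around.around fuel x xs) (splits-unique xs!)
    (λ {(l , r)} lr∈ → let l! , r! , _ = Interleaving-unique (∈-splits⁻ xs lr∈) xs! in
      concatMap-unique _ (arrangements-unique fuel l!)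
        (λ {l′} _ → Unique.map⁺ (List.∷-injectiveʳ ∘ List.++-cancelˡ l′ _ _) (arrangements-unique fuel r!))
        (λ p q s t → determined-l lr∈ p q s t))
    determined
  where
  x∉ : ∀ {l r l′} → (l , r) ∈ splits xs → l′ ∈ arrangements fuel l → x ∉ l′
  x∉ {l} lr∈ l′∈ x∈l′ = Unique.Unique[x∷xs]⇒x∉xs x∷xs!
    (Interleaving-⊆ˡ (∈-splits⁻ xs lr∈) (Perm.∈-resp-↭ (∈-arrangements⁻ fuel l l′∈) x∈l′))

  determined-l : ∀ {l r l₁ l₂ z} → (l , r) ∈ splits xs → l₁ ∈ arrangements fuel l → l₂ ∈ arrangements fuel l →
                 z ∈ map (λ r′ → l₁ ++ x ∷ r′) (arrangements fuel r) →
                 z ∈ map (λ r′ → l₂ ++ x ∷ r′) (arrangements fuel r) → l₁ ≡ l₂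
  determined-l lr∈ l₁∈ l₂∈ p q with ∈.∈-map⁻ _ p | ∈.∈-map⁻ _ q
  ... | _ , _ , refl | _ , _ , eq = proj₁ (++-∷-injective _ (x∉ lr∈ l₁∈) (x∉ lr∈ l₂∈) eq)

  determined : ∀ {s t z} → s ∈ splits xs → t ∈ splits xs →
               z ∈ Around.around fuel x xs s → z ∈ Around.around fuel x xs t → s ≡ t
  determined {l , r} {l₁ , r₁} s∈ t∈ p q with ∈-around⁻ fuel x xs l r p | ∈-around⁻ fuel x xs l₁ r₁ q
  ... | l′ , r′ , l′∈ , r′∈ , refl | l₁′ , r₁′ , l₁′∈ , r₁′∈ , eq
    with refl , refl ← ++-∷-injective l′ (x∉ s∈ l′∈) (x∉ t∈ l₁′∈) eq =
    Interleaving-determined xs! (∈-splits⁻ xs s∈) (∈-splits⁻ xs t∈)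
      (Perm.trans (Perm.↭-sym (∈-arrangements⁻ fuel l l′∈)) (∈-arrangements⁻ fuel l₁ l₁′∈))
      (Perm.trans (Perm.↭-sym (∈-arrangements⁻ fuel r r′∈)) (∈-arrangements⁻ fuel r₁ r₁′∈))

-- The fibre sizes as products

∈-map-just⁻ : ∀ {x : A} {xs} → just x ∈ map just xs → x ∈ xs
∈-map-just⁻ jx∈ with _ , x∈xs , refl ← ∈.∈-map⁻ just jx∈ = x∈xs

-- Mirrors `arrangements`, down to the empty list when the fuel runs out, but sees only the number
-- of cars. The factor `suc i` is put on the left list to match the left-nested product of the
-- theorem.
fibreSizes : (fuel n : ℕ) → List ℕ
fibreSizes _          zero    = [ 1 ]
fibreSizes zero       (suc n) = []
fibreSizes (suc fuel) (suc n) =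
  concatMap (λ i → products (map (suc i *_) (fibreSizes fuel i)) (fibreSizes fuel (n ∸ i))) (subsetSizes n)

∈-products⁻ : ∀ as bs {x} → x ∈ products as bs → ∃₂ λ a b → a ∈ as × b ∈ bs × x ≡ a * b
∈-products⁻ as bs x∈ with ∈-concatMap⁻ (λ a → map (a *_) bs) as x∈
... | a , a∈ , x∈′ with ∈.∈-map⁻ (a *_) x∈′
...   | b , b∈ , x≡ab = a , b , a∈ , b∈ , x≡ab

-- By induction, since i! (n-i)! divides n! and i + 1 ≤ n + 1. This bound is what allows the sum
-- defining `G n` to stop at n!.
fibreSizes-≤ : ∀ fuel n {a} → a ∈ fibreSizes fuel n → a ≤ n !
fibreSizes-≤ fuel       zero    (here refl) = ℕ.≤-refl
fibreSizes-≤ (suc fuel) (suc n) a∈ with ∈-concatMap⁻ (λ i → products (map (suc i *_) (fibreSizes fuel i)) (fibreSizes fuel (n ∸ i))) (subsetSizes n) a∈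
... | i , i∈ , a∈′ with ∈-products⁻ (map (suc i *_) (fibreSizes fuel i)) (fibreSizes fuel (n ∸ i)) a∈′
...   | _ , d , b∈ , d∈ , refl with ∈.∈-map⁻ (suc i *_) b∈
...     | b , b∈′ , refl = begin
  suc i * b * d            ≡⟨ ℕ.*-assoc (suc i) b d ⟩
  suc i * (b * d)          ≤⟨ ℕ.*-mono-≤ (s≤s i≤n) (ℕ.*-mono-≤ (fibreSizes-≤ fuel i b∈′) (fibreSizes-≤ fuel (n ∸ i) d∈)) ⟩
  suc n * (i ! * (n ∸ i) !) ≤⟨ ℕ.*-monoʳ-≤ (suc n) (∣⇒≤ {{n ℕ.!≢0}} (k![n∸k]!∣n! i≤n)) ⟩
  suc n * n !              ∎
  where
  open ℕ.≤-Reasoning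
  i≤n = All.lookup (subsetSizes≤ n) i∈

-- Weights of streets and their factorisation at the spot of the last car

module Weight {a} {A : Set a} (_≟_ : DecidableEquality A) where

  vacateSpot : A → Maybe A → Maybe A
  vacateSpot x nothing  = nothing
  vacateSpot x (just y) = if does (x ≟ y) then nothing else just y

  vacate : A → List (Maybe A) → List (Maybe A)
  vacate x = map (vacateSpot x)

  -- The number of preferences that make x park where it stands in s, if s is
  -- preceded by k occupied spots; 1 if x is absent.
  choices : ℕ → A → List (Maybe A) → ℕ
  choices k x []            = 1
  choices k x (nothing ∷ s) = choices 0 x s
  choices k x (just y ∷ s)  = if does (x ≟ y) then suc k else choices (suc k) x s

  -- The cars are listed from the last arrival to the first.
  weight : List A → List (Maybe A) → ℕ
  weight []       s = 1
  weight (x ∷ xs) s = choices 0 x s * weight xs (vacate x s)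

  vacate-⊆ : ∀ {x y} s → just y ∈ vacate x s → just y ∈ s
  vacate-⊆ {x} (nothing ∷ s) (there y∈) = there (vacate-⊆ s y∈)
  vacate-⊆ {x} (just z ∷ s)  y∈ with does (x ≟ z)
  vacate-⊆ {x} (just z ∷ s)  (there y∈)  | true  = there (vacate-⊆ s y∈)
  vacate-⊆ {x} (just z ∷ s)  (here refl) | false = here refl
  vacate-⊆ {x} (just z ∷ s)  (there y∈)  | false = there (vacate-⊆ s y∈)

  vacate-∉ : ∀ x {s} → just x ∉ s → vacate x s ≡ s
  vacate-∉ x {[]}          x∉s = refl
  vacate-∉ x {nothing ∷ s} x∉s = cong (nothing ∷_) (vacate-∉ x (x∉s ∘ there))
  vacate-∉ x {just y ∷ s}  x∉s with x ≟ y
  ... | yes refl = contradiction (here refl) x∉s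
  ... | no  _    = cong (just y ∷_) (vacate-∉ x (x∉s ∘ there))

  choices-∉ : ∀ k x {s} → just x ∉ s → choices k x s ≡ 1
  choices-∉ k x {[]}          x∉s = refl
  choices-∉ k x {nothing ∷ s} x∉s = choices-∉ 0 x (x∉s ∘ there)
  choices-∉ k x {just y ∷ s}  x∉s with x ≟ y
  ... | yes refl = contradiction (here refl) x∉s
  ... | no  _    = choices-∉ (suc k) x (x∉s ∘ there)

  -- The empty spot resets the counter, and a part without x contributes the factor 1.
  choices-++ : ∀ k x l r → (just x ∈ l → just x ∉ r) →
               choices k x (l ++ nothing ∷ r) ≡ choices k x l * choices 0 x r
  choices-++ k x []            r l#r = sym (ℕ.*-identityˡ (choices 0 x r))
  choices-++ k x (nothing ∷ l) r l#r = choices-++ 0 x l r (l#r ∘ there)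
  choices-++ k x (just y ∷ l)  r l#r with x ≟ y
  ... | yes refl = sym (trans (cong (suc k *_) (choices-∉ 0 x (l#r (here refl)))) (ℕ.*-identityʳ (suc k)))
  ... | no  _    = choices-++ (suc k) x l r (l#r ∘ there)

  -- An empty spot separates the street into independent parts.
  weight-++ : ∀ xs l r → (∀ {x} → just x ∈ l → just x ∉ r) →
              weight xs (l ++ nothing ∷ r) ≡ weight xs l * weight xs r
  weight-++ []       l r l#r = refl
  weight-++ (x ∷ xs) l r l#r = begin
    choices 0 x (l ++ nothing ∷ r) * weight xs (vacate x (l ++ nothing ∷ r))
      ≡⟨ cong₂ _*_ (choices-++ 0 x l r l#r) (trans (cong (weight xs) (List.map-++ (vacateSpot x) l (nothing ∷ r)))
           (weight-++ xs (vacate x l) (vacate x r) (λ y∈l → l#r (vacate-⊆ l y∈l) ∘ vacate-⊆ r))) ⟩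
    (choices 0 x l * choices 0 x r) * (weight xs (vacate x l) * weight xs (vacate x r))
      ≡⟨ ℕ.[m*n]*[o*p]≡[m*o]*[n*p] (choices 0 x l) (choices 0 x r) _ _ ⟩
    weight (x ∷ xs) l * weight (x ∷ xs) r  ∎
    where open ≡-Reasoning

  -- A car absent from `s` has factor 1, and vacating its spot leaves `s` unchanged.
  weight-restrict : ∀ {ys zs xs} → Interleaving ys zs xs → ∀ s → (∀ {z} → z ∈ zs → just z ∉ s) →
                    weight xs s ≡ weight ys s
  weight-restrict []                 s zs#s = refl
  weight-restrict {x ∷ _} (consˡ i) s zs#s = cong (choices 0 x s *_)
    (weight-restrict i (vacate x s) (λ z∈zs → zs#s z∈zs ∘ vacate-⊆ s))
  weight-restrict {xs = z ∷ xs} (consʳ i) s zs#s = trans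
    (cong₂ _*_ (choices-∉ 0 z (zs#s (here refl))) (cong (weight xs) (vacate-∉ z (zs#s (here refl)))))
    (trans (ℕ.*-identityˡ (weight xs s)) (weight-restrict i s (zs#s ∘ there)))

  choices-full : ∀ k {x} l s → x ∉ l → choices k x (map just l ++ just x ∷ s) ≡ suc (length l + k)
  choices-full k {x} [] s x∉l with x ≟ x
  ... | yes _  = refl
  ... | no x≢x = contradiction refl x≢x
  choices-full k {x} (y ∷ l) s x∉l with x ≟ y
  ... | yes refl = contradiction (here refl) x∉l
  ... | no  _    = trans (choices-full (suc k) l s (x∉l ∘ there)) (cong suc (ℕ.+-suc (length l) k))

  vacateSpot-≡ : ∀ x → vacateSpot x (just x) ≡ nothing
  vacateSpot-≡ x with x ≟ x
  ... | yes _  = refl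
  ... | no x≢x = contradiction refl x≢x

  vacate-full : ∀ x {l r} → x ∉ l → x ∉ r →
                vacate x (map just l ++ just x ∷ map just r) ≡ map just l ++ nothing ∷ map just r
  vacate-full x {l} {r} x∉l x∉r = trans (List.map-++ (vacateSpot x) (map just l) (just x ∷ map just r))
    (cong₂ _++_ (vacate-∉ x (x∉l ∘ ∈-map-just⁻))
      (cong₂ _∷_ (vacateSpot-≡ x) (vacate-∉ x (x∉r ∘ ∈-map-just⁻))))

  -- All spots before x are taken, which gives the factor 1 + length l. Removing x leaves an empty
  -- spot at which the weight factors, and each part ignores the cars of the other.
  weight-split : ∀ {x xs l r l′ r′} → Unique (x ∷ xs) → Interleaving l r xs → l′ ↭ l → r′ ↭ r →
    weight (x ∷ xs) (map just (l′ ++ x ∷ r′)) ≡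
    suc (length l) * weight l (map just l′) * weight r (map just r′)
  weight-split {x} {xs} {l} {r} {l′} {r′} x∷xs!@(_ ∷ xs!) i l′↭l r′↭r = begin
    weight (x ∷ xs) (map just (l′ ++ x ∷ r′))
      ≡⟨ cong (weight (x ∷ xs)) (List.map-++ just l′ (x ∷ r′)) ⟩
    weight (x ∷ xs) (map just l′ ++ just x ∷ map just r′)
      ≡⟨ cong₂ _*_ (choices-full 0 l′ _ x∉l′) (cong (weight xs) (vacate-full x x∉l′ x∉r′)) ⟩
    suc (length l′ + 0) * weight xs (map just l′ ++ nothing ∷ map just r′)
      ≡⟨ cong₂ _*_ (cong suc (trans (ℕ.+-identityʳ (length l′)) (Perm.↭-length l′↭l)))
           (weight-++ xs (map just l′) (map just r′)
             (λ y∈l′ y∈r′ → l#r (Perm.∈-resp-↭ l′↭l (∈-map-just⁻ y∈l′) , Perm.∈-resp-↭ r′↭r (∈-map-just⁻ y∈r′)))) ⟩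
    suc (length l) * (weight xs (map just l′) * weight xs (map just r′))
      ≡⟨ ℕ.*-assoc (suc (length l)) (weight xs (map just l′)) (weight xs (map just r′)) ⟨
    suc (length l) * weight xs (map just l′) * weight xs (map just r′)
      ≡⟨ cong₂ _*_ (cong (suc (length l) *_)
           (weight-restrict i (map just l′) (λ z∈r z∈l′ → l#r (Perm.∈-resp-↭ l′↭l (∈-map-just⁻ z∈l′) , z∈r))))
           (weight-restrict (Interleaving.swap i) (map just r′)
             (λ z∈l z∈r′ → l#r (z∈l , Perm.∈-resp-↭ r′↭r (∈-map-just⁻ z∈r′)))) ⟩
    suc (length l) * weight l (map just l′) * weight r (map just r′)  ∎
    where
    open ≡-Reasoning
    l#r : Disjoint l r
    l#r = proj₂ (proj₂ (Interleaving-unique i xs!))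
    x∉xs = Unique.Unique[x∷xs]⇒x∉xs x∷xs!
    x∉l′ : x ∉ l′
    x∉l′ = x∉xs ∘ Interleaving-⊆ˡ i ∘ Perm.∈-resp-↭ l′↭l
    x∉r′ : x ∉ r′
    x∉r′ = x∉xs ∘ Interleaving-⊆ʳ i ∘ Perm.∈-resp-↭ r′↭r

  weights : ℕ → List A → List ℕ
  weights fuel xs = map (weight xs ∘ map just) (arrangements fuel xs)

  -- The right side knows only the length of `xs`, which takes the place of standardising the parts.
  -- The lists agree in order, not just as multisets, since `splits` and `subsetSizes` enumerate in
  -- the same way.
  weights≡fibreSizes : ∀ fuel {xs} → Unique xs → weights fuel xs ≡ fibreSizes fuel (length xs)
  weights≡fibreSizes fuel       []                        = refl
  weights≡fibreSizes zero       (_ ∷ _)                   = refl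
  weights≡fibreSizes (suc fuel) {x ∷ xs} x∷xs!@(_ ∷ xs!) = begin
    map w (concatMap (Around.around fuel x xs) (splits xs))
      ≡⟨ List.map-concatMap w (Around.around fuel x xs) (splits xs) ⟩
    concatMap (map w ∘ Around.around fuel x xs) (splits xs)
      ≡⟨ concatMap-cong-local around ⟩
    concatMap (sizes ∘ length ∘ proj₁) (splits xs)
      ≡⟨ List.concatMap-map sizes (length ∘ proj₁) (splits xs) ⟨
    concatMap sizes (map (length ∘ proj₁) (splits xs))
      ≡⟨ cong (concatMap sizes) (splits-sizes xs) ⟩
    concatMap sizes (subsetSizes (length xs))  ∎
    where
    open ≡-Reasoning
    w = weight (x ∷ xs) ∘ map just
    sizes : ℕ → List ℕ
    sizes i = products (map (suc i *_) (fibreSizes fuel i)) (fibreSizes fuel (length xs ∸ i))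
    around : ∀ {s} → s ∈ splits xs → map w (Around.around fuel x xs s) ≡ sizes (length (proj₁ s))
    around {l , r} lr∈ = begin
      map w (concatMap (λ l′ → map (λ r′ → l′ ++ x ∷ r′) rs) ls)
        ≡⟨ List.map-concatMap w (λ l′ → map (λ r′ → l′ ++ x ∷ r′) rs) ls ⟩
      concatMap (λ l′ → map w (map (λ r′ → l′ ++ x ∷ r′) rs)) ls
        ≡⟨ concatMap-cong-local (λ {l′} l′∈ → trans (sym (List.map-∘ rs)) (trans
             (List.map-cong-local (All.tabulate λ r′∈ →
               weight-split x∷xs! i (∈-arrangements⁻ fuel l l′∈) (∈-arrangements⁻ fuel r r′∈)))
             (List.map-∘ rs))) ⟩
      concatMap (λ l′ → map (suc (length l) * weight l (map just l′) *_) (weights fuel r)) ls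
        ≡⟨ List.concatMap-map (λ b → map (b *_) (weights fuel r)) (λ l′ → suc (length l) * weight l (map just l′)) ls ⟨
      products (map (λ l′ → suc (length l) * weight l (map just l′)) ls) (weights fuel r)
        ≡⟨ cong₂ products (trans (List.map-∘ ls) (cong (map (suc (length l) *_)) (weights≡fibreSizes fuel l!)))
             (trans (weights≡fibreSizes fuel r!) (cong (fibreSizes fuel) (length-splitʳ i))) ⟩
      sizes (length l)  ∎
      where
      i = ∈-splits⁻ xs lr∈
      l! = proj₁ (Interleaving-unique i xs!)
      r! = proj₁ (proj₂ (Interleaving-unique i xs!))
      ls = arrangements fuel l
      rs = arrangements fuel r

-- Counting the elements of a list with a decidable property

⟦_⟧ : Dec P → ℕ
⟦ P? ⟧ = if does P? then 1 else 0

⟦⟧-yes : (P? : Dec P) → P → ⟦ P? ⟧ ≡ 1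
⟦⟧-yes (yes _) _  = refl
⟦⟧-yes (no ¬p) p  = contradiction p ¬p

⟦⟧-no : (P? : Dec P) → ¬ P → ⟦ P? ⟧ ≡ 0
⟦⟧-no (yes p) ¬p = contradiction p ¬p
⟦⟧-no (no _)  _  = refl

⟦⟧-cong : (P? : Dec P) (Q? : Dec Q) → (P → Q) → (Q → P) → ⟦ P? ⟧ ≡ ⟦ Q? ⟧
⟦⟧-cong (yes p) Q? to from = sym (⟦⟧-yes Q? (to p))
⟦⟧-cong (no ¬p) Q? to from = sym (⟦⟧-no Q? (¬p ∘ from))

count : {P : Pred A p} → Decidable P → List A → ℕ
count P? []       = 0
count P? (x ∷ xs) = ⟦ P? x ⟧ + count P? xs

length-filter≡count : {P : Pred A p} (P? : Decidable P) → ∀ xs → length (filter P? xs) ≡ count P? xs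
length-filter≡count P? []       = refl
length-filter≡count P? (x ∷ xs) with does (P? x)
... | true  = cong suc (length-filter≡count P? xs)
... | false = length-filter≡count P? xs

count-filter : {P : Pred A p} {Q : Pred A q} (P? : Decidable P) (Q? : Decidable Q) → P ⊆ Q →
               ∀ xs → count P? (filter Q? xs) ≡ count P? xs
count-filter P? Q? P⊆Q []       = refl
count-filter P? Q? P⊆Q (x ∷ xs) with Q? x
... | yes _  = cong (⟦ P? x ⟧ +_) (count-filter P? Q? P⊆Q xs)
... | no ¬qx = trans (count-filter P? Q? P⊆Q xs) (cong (_+ count P? xs) (sym (⟦⟧-no (P? x) (¬qx ∘ P⊆Q))))

count-cong : {P : Pred A p} {Q : Pred A q} (P? : Decidable P) (Q? : Decidable Q) →
             P ⊆ Q → Q ⊆ P → ∀ xs → count P? xs ≡ count Q? xs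
count-cong P? Q? P⊆Q Q⊆P []       = refl
count-cong P? Q? P⊆Q Q⊆P (x ∷ xs) = cong₂ _+_ (⟦⟧-cong (P? x) (Q? x) P⊆Q Q⊆P) (count-cong P? Q? P⊆Q Q⊆P xs)

count-none : {P : Pred A p} (P? : Decidable P) → (∀ x → ¬ P x) → ∀ xs → count P? xs ≡ 0
count-none P? ¬P []       = refl
count-none P? ¬P (x ∷ xs) = cong₂ _+_ (⟦⟧-no (P? x) (¬P x)) (count-none P? ¬P xs)

count-++ : {P : Pred A p} (P? : Decidable P) → ∀ xs ys → count P? (xs ++ ys) ≡ count P? xs + count P? ys
count-++ P? []       ys = refl
count-++ P? (x ∷ xs) ys = trans (cong (⟦ P? x ⟧ +_) (count-++ P? xs ys)) (sym (ℕ.+-assoc ⟦ P? x ⟧ _ _))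

count-map : {P : Pred B p} (P? : Decidable P) (f : A → B) → ∀ xs → count P? (map f xs) ≡ count (P? ∘ f) xs
count-map P? f []       = refl
count-map P? f (x ∷ xs) = cong (⟦ P? (f x) ⟧ +_) (count-map P? f xs)

-- In its use, x is a first preference and `ys` lists the possible continuations: an admissible x
-- always admits k of them, any other x none.
count-cartesianProductWith : ∀ {r} {D : Set r} {P : Pred D p} {Q : Pred A q} (P? : Decidable P) (Q? : Decidable Q)
  (f : A → B → D) {ys k} → (∀ x → count (P? ∘ f x) ys ≡ ⟦ Q? x ⟧ * k) →
  ∀ xs → count P? (cartesianProductWith f xs ys) ≡ count Q? xs * k
count-cartesianProductWith P? Q? f          eq []       = refl
count-cartesianProductWith P? Q? f {ys} {k} eq (x ∷ xs) = begin
  count P? (map (f x) ys ++ cartesianProductWith f xs ys)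
    ≡⟨ count-++ P? (map (f x) ys) _ ⟩
  count P? (map (f x) ys) + count P? (cartesianProductWith f xs ys)
    ≡⟨ cong₂ _+_ (trans (count-map P? (f x) ys) (eq x)) (count-cartesianProductWith P? Q? f eq xs) ⟩
  ⟦ Q? x ⟧ * k + count Q? xs * k
    ≡⟨ ℕ.*-distribʳ-+ k ⟦ Q? x ⟧ (count Q? xs) ⟨
  count Q? (x ∷ xs) * k  ∎
  where open ≡-Reasoning

count-allFin-suc : ∀ {n} {P : Pred (Fin (suc n)) p} (P? : Decidable P) →
                   count P? (allFin (suc n)) ≡ ⟦ P? zero ⟧ + count (P? ∘ suc) (allFin n)
count-allFin-suc {n = n} P? = cong (⟦ P? zero ⟧ +_)
  (trans (cong (count P?) (sym (List.map-tabulate (λ i → i) suc))) (count-map P? suc (allFin n)))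

-- Parking car by car, and counting the preferences that lead to a given street

module Parking {A : Set} (_≟_ : DecidableEquality A) where

  open Weight _≟_

  infix 4 _≟ˢ_

  _≟ˢ_ : ∀ {n} → DecidableEquality (Maybe (Vec (Maybe A) n))
  _≟ˢ_ = Maybe.≡-dec (Vec.≡-dec (Maybe.≡-dec _≟_))

  vacateᵛ : ∀ {n} → A → Vec (Maybe A) n → Vec (Maybe A) n
  vacateᵛ x = Vec.map (vacateSpot x)

  toList-vacateᵛ : ∀ {n} x (t : Vec (Maybe A) n) → toList (vacateᵛ x t) ≡ vacate x (toList t)
  toList-vacateᵛ x t = Vec.toList-map (vacateSpot x) t

  vacateSpot-≢ : ∀ {x y} → y ≢ just x → vacateSpot x y ≡ y
  vacateSpot-≢ {x} {nothing} _   = refl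
  vacateSpot-≢ {x} {just y}  y≢x with x ≟ y
  ... | yes refl = contradiction refl y≢x
  ... | no  _    = refl

  vacateᵛ-∉ : ∀ {n} x (t : Vec (Maybe A) n) → just x ∉ toList t → vacateᵛ x t ≡ t
  vacateᵛ-∉ x []      x∉t = refl
  vacateᵛ-∉ x (y ∷ t) x∉t = cong₂ _∷_ (vacateSpot-≢ (x∉t ∘ here ∘ sym)) (vacateᵛ-∉ x t (x∉t ∘ there))

  vacateᵛ-⊆ : ∀ {n} x {y} (t : Vec (Maybe A) n) → just y ∈ toList (vacateᵛ x t) → just y ∈ toList t
  vacateᵛ-⊆ x t y∈ = vacate-⊆ (toList t) (subst (just _ ∈_) (toList-vacateᵛ x t) y∈)

  ∉-vacateᵛ : ∀ {n} x (t : Vec (Maybe A) n) → just x ∉ toList (vacateᵛ x t)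
  ∉-vacateᵛ x (nothing ∷ t) (there x∈) = ∉-vacateᵛ x t x∈
  ∉-vacateᵛ x (just y ∷ t)  x∈ with x ≟ y
  ∉-vacateᵛ x (just y ∷ t)  (there x∈)  | yes _  = ∉-vacateᵛ x t x∈
  ∉-vacateᵛ x (just y ∷ t)  (here refl) | no x≢x = x≢x refl
  ∉-vacateᵛ x (just y ∷ t)  (there x∈)  | no _   = ∉-vacateᵛ x t x∈

  data Once (x : A) : List (Maybe A) → Set where
    here  : ∀ {s} → just x ∉ s → Once x (just x ∷ s)
    there : ∀ {y s} → y ≢ just x → Once x s → Once x (y ∷ s)

  ∈⇒Once : ∀ {x xs} → Unique xs → x ∈ xs → Once x (map just xs)
  ∈⇒Once xs!       (here refl)  = here (Unique.Unique[x∷xs]⇒x∉xs xs! ∘ ∈-map-just⁻)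
  ∈⇒Once xs!@(_ ∷ ys!) (there x∈xs) =
    there (λ { refl → Unique.Unique[x∷xs]⇒x∉xs xs! x∈xs }) (∈⇒Once ys! x∈xs)

  Once-vacateᵛ : ∀ {n x y} (t : Vec (Maybe A) n) → y ≢ x → Once x (toList t) → Once x (toList (vacateᵛ y t))
  Once-vacateᵛ {x = x} {y} (just .x ∷ t) y≢x (here x∉t) =
    subst (λ z → Once x (z ∷ toList (vacateᵛ y t))) (sym (vacateSpot-≢ (λ { refl → y≢x refl })))
      (here (x∉t ∘ vacateᵛ-⊆ y t))
  Once-vacateᵛ {x = x} {y} (z ∷ t) y≢x (there z≢x once) = there (vacateSpot-other z z≢x) (Once-vacateᵛ t y≢x once)
    where
    vacateSpot-other : ∀ z → z ≢ just x → vacateSpot y z ≢ just x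
    vacateSpot-other nothing  z≢x = z≢x
    vacateSpot-other (just w) z≢x with does (y ≟ w)
    ... | true  = λ ()
    ... | false = z≢x

  -- Forgets the preference: only the spot that x took matters for the street that results.
  data Parked (x : A) : ∀ {n} → Vec (Maybe A) n → Vec (Maybe A) n → Set where
    here  : ∀ {n} {t : Vec (Maybe A) n} → Parked x (nothing ∷ t) (just x ∷ t)
    there : ∀ {n y} {t t′ : Vec (Maybe A) n} → Parked x t t′ → Parked x (y ∷ t) (y ∷ t′)

  park⇒Parked : ∀ {n} x a (t : Vec (Maybe A) n) {t′} → park x a t ≡ just t′ → Parked x t t′
  park⇒Parked x (suc a) (y ∷ t) eq with park x a t in eq′
  park⇒Parked x (suc a) (y ∷ t) refl | just _ = there (park⇒Parked x a t eq′)
  park⇒Parked x zero (nothing ∷ t) refl = here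
  park⇒Parked x zero (just y ∷ t@(_ ∷ _)) eq with park x zero t in eq′
  park⇒Parked x zero (just y ∷ t@(_ ∷ _)) refl | just _ = there (park⇒Parked x zero t eq′)

  Parked-vacateᵛ : ∀ {n x} {t t′ : Vec (Maybe A) n} → Parked x t t′ → just x ∉ toList t → vacateᵛ x t′ ≡ t
  Parked-vacateᵛ {x = x} (here {t = t}) x∉t = cong₂ _∷_ (vacateSpot-≡ x) (vacateᵛ-∉ x t (x∉t ∘ there))
  Parked-vacateᵛ (there parked) x∉t =
    cong₂ _∷_ (vacateSpot-≢ (x∉t ∘ here ∘ sym)) (Parked-vacateᵛ parked (x∉t ∘ there))

  Parked-∈ : ∀ {n x y} {t t′ : Vec (Maybe A) n} → Parked x t t′ → just y ∈ toList t′ → y ≡ x ⊎ just y ∈ toList t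
  Parked-∈ here           (here refl) = inj₁ refl
  Parked-∈ here           (there y∈)  = inj₂ (there y∈)
  Parked-∈ (there parked) (here refl) = inj₂ (here refl)
  Parked-∈ (there parked) (there y∈) with Parked-∈ parked y∈
  ... | inj₁ y≡x = inj₁ y≡x
  ... | inj₂ y∈t = inj₂ (there y∈t)

  Completes : ∀ {n} → A → Vec (Maybe A) n → Fin n → Set
  Completes x t a = park x a (vacateᵛ x t) ≡ just t

  completes? : ∀ {n} x (t : Vec (Maybe A) n) → Decidable (Completes x t)
  completes? x t a = park x a (vacateᵛ x t) ≟ˢ just t

  map-∷-just⁻ : ∀ {n} {y z : Maybe A} (m : Maybe (Vec (Maybe A) n)) {t} →
                Maybe.map (y ∷_) m ≡ just (z ∷ t) → y ≡ z × m ≡ just t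
  map-∷-just⁻ (just _) refl = refl , refl

  Completes-suc⁺ : ∀ {n x y} {t : Vec (Maybe A) n} {a} → y ≢ just x → Completes x t a → Completes x (y ∷ t) (suc a)
  Completes-suc⁺ y≢x = cong₂ (λ y m → Maybe.map (y ∷_) m) (vacateSpot-≢ y≢x)

  Completes-suc⁻ : ∀ {n x y} {t : Vec (Maybe A) n} {a} → Completes x (y ∷ t) (suc a) → vacateSpot x y ≡ y × Completes x t a
  Completes-suc⁻ = map-∷-just⁻ _

  Completes-zero⁺ : ∀ {n x y} {t : Vec (Maybe A) (suc n)} → y ≢ x → Completes x t zero → Completes x (just y ∷ t) zero
  Completes-zero⁺ {x = x} {y} {z ∷ t} y≢x completes
    rewrite vacateSpot-≢ {x} {just y} (y≢x ∘ Maybe.just-injective) = cong (Maybe.map (just y ∷_)) completes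

  Completes-zero⁻ : ∀ {n x y} {t : Vec (Maybe A) (suc n)} → y ≢ x → Completes x (just y ∷ t) zero → Completes x t zero
  Completes-zero⁻ {x = x} {y} {z ∷ t} y≢x completes
    rewrite vacateSpot-≢ {x} {just y} (y≢x ∘ Maybe.just-injective) = proj₂ (map-∷-just⁻ _ completes)

  Completes-here : ∀ {n x} {t : Vec (Maybe A) n} → just x ∉ toList t → Completes x (just x ∷ t) zero
  Completes-here {x = x} {t} x∉t rewrite vacateSpot-≡ x = cong (λ t → just (just x ∷ t)) (vacateᵛ-∉ x t x∉t)

  count-completes-suc : ∀ {n x y} (t : Vec (Maybe A) n) → y ≢ just x →
    count (completes? x (y ∷ t) ∘ suc) (allFin n) ≡ count (completes? x t) (allFin n)
  count-completes-suc {n} {x} {y} t y≢x = count-cong (completes? x (y ∷ t) ∘ suc) (completes? x t)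
    (λ {a} → proj₂ ∘ Completes-suc⁻ {y = y} {t} {a}) (λ {a} → Completes-suc⁺ {t = t} {a} y≢x) (allFin n)

  -- The k occupied spots in front of `t` make the induction work: preferring any of them amounts to
  -- preferring the first spot of `t`, whence the second summand. An occupied head other than x
  -- raises k by one, an empty head resets it.
  count-completes : ∀ {n} k x (t : Vec (Maybe A) (suc n)) → Once x (toList t) →
    count (completes? x t) (allFin (suc n)) + k * ⟦ completes? x t zero ⟧ ≡ choices k x (toList t)
  count-completes {n} k x (just .x ∷ t) (here x∉t) = begin
    count (completes? x (just x ∷ t)) (allFin (suc n)) + k * ⟦ completes? x (just x ∷ t) zero ⟧
      ≡⟨ cong₂ _+_ (trans (count-allFin-suc (completes? x (just x ∷ t))) (cong₂ _+_ first
           (count-none (completes? x (just x ∷ t) ∘ suc) none (allFin n)))) (cong (k *_) first) ⟩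
    suc (k * 1)
      ≡⟨ cong suc (ℕ.*-identityʳ k) ⟩
    suc k
      ≡⟨ choices-full k [] (toList t) (λ ()) ⟨
    choices k x (just x ∷ toList t)  ∎
    where
    open ≡-Reasoning
    first : ⟦ completes? x (just x ∷ t) zero ⟧ ≡ 1
    first = ⟦⟧-yes (completes? x (just x ∷ t) zero) (Completes-here x∉t)
    none : ∀ a → ¬ Completes x (just x ∷ t) (suc a)
    none a completes with () ← trans (sym (vacateSpot-≡ x)) (proj₁ (Completes-suc⁻ {y = just x} {t} {a} completes))
  count-completes {suc n} k x (nothing ∷ t) (there y≢x once) = begin
    count (completes? x (nothing ∷ t)) (allFin (suc (suc n))) + k * ⟦ completes? x (nothing ∷ t) zero ⟧
      ≡⟨ cong₂ _+_ (trans (count-allFin-suc (completes? x (nothing ∷ t))) (cong₂ _+_ first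
           (count-completes-suc t y≢x))) (trans (cong (k *_) first) (ℕ.*-zeroʳ k)) ⟩
    count (completes? x t) (allFin (suc n)) + 0
      ≡⟨ count-completes 0 x t once ⟩
    choices 0 x (toList t)  ∎
    where
    open ≡-Reasoning
    -- The empty spot would catch x, so neither this preference nor one further back leads to the
    -- spot of x.
    first : ⟦ completes? x (nothing ∷ t) zero ⟧ ≡ 0
    first = ⟦⟧-no (completes? x (nothing ∷ t) zero) λ ()
  count-completes {suc n} k x (just y ∷ t) (there y≢x once) = begin
    count (completes? x (just y ∷ t)) (allFin (suc (suc n))) + k * ⟦ completes? x (just y ∷ t) zero ⟧
      ≡⟨ cong₂ _+_ (trans (count-allFin-suc (completes? x (just y ∷ t))) (cong₂ _+_ first
           (count-completes-suc t y≢x))) (cong (k *_) first) ⟩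
    (e + m) + k * e
      ≡⟨ solve 3 (λ e m k → (e :+ m) :+ k :* e := m :+ (e :+ k :* e)) refl e m k ⟩
    m + suc k * e
      ≡⟨ count-completes (suc k) x t once ⟩
    choices (suc k) x (toList t)
      ≡⟨ choices-≢ ⟨
    choices k x (just y ∷ toList t)  ∎
    where
    open ≡-Reasoning
    open ℕ.+-*-Solver using (solve; _:+_; _:*_; _:=_)
    e = ⟦ completes? x t zero ⟧
    m = count (completes? x t) (allFin (suc n))
    first : ⟦ completes? x (just y ∷ t) zero ⟧ ≡ e
    first = ⟦⟧-cong (completes? x (just y ∷ t) zero) (completes? x t zero)
      (Completes-zero⁻ {t = t} (y≢x ∘ cong just)) (Completes-zero⁺ {t = t} (y≢x ∘ cong just))
    choices-≢ : choices k x (just y ∷ toList t) ≡ choices (suc k) x (toList t)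
    choices-≢ with x ≟ y
    ... | yes refl = contradiction refl y≢x
    ... | no  _    = refl
  count-completes {zero} k x (_ ∷ []) (there _ ())

  -- Generalises `outcome` to any starting street and any remaining cars, so that the earliest car
  -- can be peeled off.
  run : ∀ {n k} → Maybe (Vec (Maybe A) n) → Vec A k → Vec (Fin n) k → Maybe (Vec (Maybe A) n)
  run m []       []      = m
  run m (x ∷ xs) (a ∷ α) = run (m >>= park x a) xs α

  run-nothing : ∀ {n k} (xs : Vec A k) (α : Vec (Fin n) k) → run nothing xs α ≡ nothing
  run-nothing []       []      = refl
  run-nothing (x ∷ xs) (a ∷ α) = run-nothing xs α

  vacateAll : ∀ {n k} → Vec A k → Vec (Maybe A) n → Vec (Maybe A) n
  vacateAll []       s = s
  vacateAll (x ∷ xs) s = vacateᵛ x (vacateAll xs s)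

  -- A parked car never moves, so the street before the cars xs arrive is the final
  -- street with their spots vacated.
  run-determined : ∀ {n k} (xs : Vec A k) (α : Vec (Fin n) k) {t s} → Unique (toList xs) →
    (∀ {x} → x ∈ toList xs → just x ∉ toList t) → run (just t) xs α ≡ just s → t ≡ vacateAll xs s
  run-determined []       []      xs!               xs#t refl = refl
  run-determined (x ∷ xs) (a ∷ α) {t} xs!@(_ ∷ ys!) xs#t eq with park x a t in eq′
  ... | nothing with () ← trans (sym (run-nothing xs α)) eq
  ... | just t′ with parked ← park⇒Parked x a t eq′ = trans
    (sym (Parked-vacateᵛ parked (xs#t (here refl))))
    (cong (vacateᵛ x) (run-determined xs α ys! xs#t′ eq))
    where
    xs#t′ : ∀ {y} → y ∈ toList xs → just y ∉ toList t′
    xs#t′ y∈xs y∈t′ with Parked-∈ parked y∈t′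
    ... | inj₁ refl = Unique.Unique[x∷xs]⇒x∉xs xs! y∈xs
    ... | inj₂ y∈t  = xs#t (there y∈xs) y∈t

  ∉-vacateAll : ∀ {n k} (xs : Vec A k) (s : Vec (Maybe A) n) {x} → x ∈ toList xs → just x ∉ toList (vacateAll xs s)
  ∉-vacateAll (x ∷ xs) s (here refl)  x∈ = ∉-vacateᵛ x (vacateAll xs s) x∈
  ∉-vacateAll (x ∷ xs) s (there y∈xs) y∈ = ∉-vacateAll xs s y∈xs (vacateᵛ-⊆ x (vacateAll xs s) y∈)

  Once-vacateAll : ∀ {n k x} (xs : Vec A k) (s : Vec (Maybe A) n) → x ∉ toList xs →
                   Once x (toList s) → Once x (toList (vacateAll xs s))
  Once-vacateAll []       s x∉xs once = once
  Once-vacateAll (y ∷ xs) s x∉xs once =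
    Once-vacateᵛ (vacateAll xs s) (x∉xs ∘ here ∘ sym) (Once-vacateAll xs s (x∉xs ∘ there) once)

  toList-vacateAll : ∀ {n k} (xs : Vec A k) (s : Vec (Maybe A) n) →
                     toList (vacateAll xs s) ≡ foldr vacate (toList s) (toList xs)
  toList-vacateAll []       s = refl
  toList-vacateAll (x ∷ xs) s =
    trans (toList-vacateᵛ x (vacateAll xs s)) (cong (vacate x) (toList-vacateAll xs s))

  -- `weight` takes the latest car first, `run` the earliest. At this end of the list stands the
  -- earliest car, which faces the street already vacated by all later ones.
  weight-∷ʳ : ∀ xs x s → weight (xs ∷ʳ x) s ≡ choices 0 x (foldl (flip vacate) s xs) * weight xs s
  weight-∷ʳ []       x s = refl
  weight-∷ʳ (y ∷ xs) x s = trans (cong (choices 0 y s *_) (weight-∷ʳ xs x (vacate y s)))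
    (x∙yz≈y∙xz ℕ.*-commutativeSemigroup (choices 0 y s) (choices 0 x (foldl (flip vacate) (vacate y s) xs)) (weight xs (vacate y s)))

  weight-reverse-∷ : ∀ {n k} x (xs : Vec A k) (s : Vec (Maybe A) n) →
    weight (reverse (x ∷ toList xs)) (toList s) ≡
    choices 0 x (toList (vacateAll xs s)) * weight (reverse (toList xs)) (toList s)
  weight-reverse-∷ x xs s = begin
    weight (reverse (x ∷ toList xs)) (toList s)
      ≡⟨ cong (λ ys → weight ys (toList s)) (List.unfold-reverse x (toList xs)) ⟩
    weight (reverse (toList xs) ∷ʳ x) (toList s)
      ≡⟨ weight-∷ʳ (reverse (toList xs)) x (toList s) ⟩
    choices 0 x (foldl (flip vacate) (toList s) (reverse (toList xs))) * weight (reverse (toList xs)) (toList s)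
      ≡⟨ cong (λ t → choices 0 x t * weight (reverse (toList xs)) (toList s))
           (trans (List.reverse-foldl (flip vacate) (toList s) (toList xs)) (sym (toList-vacateAll xs s))) ⟩
    choices 0 x (toList (vacateAll xs s)) * weight (reverse (toList xs)) (toList s)  ∎
    where open ≡-Reasoning

  -- By `run-determined`, the final street forces the street after the first car to be
  -- `vacateAll xs s`. So the first preference must complete that street, and the number of
  -- continuations is the same for each such preference; the counts multiply.
  count-run : ∀ {n k} (xs : Vec A k) (s : Vec (Maybe A) (suc n)) → Unique (toList xs) →
    (∀ {x} → x ∈ toList xs → Once x (toList s)) →
    count (λ α → run (just (vacateAll xs s)) xs α ≟ˢ just s) (tuples (suc n) k) ≡
    weight (reverse (toList xs)) (toList s)
  count-run []       s xs! once = trans (ℕ.+-identityʳ _) (⟦⟧-yes (just s ≟ˢ just s) refl)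
  count-run {n} {suc k} (x ∷ xs) s xs!@(_ ∷ ys!) once = begin
    count (λ α → run (just (vacateᵛ x t)) (x ∷ xs) α ≟ˢ just s) (tuples (suc n) (suc k))
      ≡⟨ count-cartesianProductWith (λ α → run (just (vacateᵛ x t)) (x ∷ xs) α ≟ˢ just s)
           (completes? x t) _∷_ {tuples (suc n) k} fixed (allFin (suc n)) ⟩
    count (completes? x t) (allFin (suc n)) * w
      ≡⟨ cong (_* w) (trans (sym (ℕ.+-identityʳ _)) (count-completes 0 x t
           (Once-vacateAll xs s (Unique.Unique[x∷xs]⇒x∉xs xs!) (once (here refl))))) ⟩
    choices 0 x (toList t) * w
      ≡⟨ weight-reverse-∷ x xs s ⟨
    weight (reverse (x ∷ toList xs)) (toList s)  ∎
    where
    open ≡-Reasoning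
    t = vacateAll xs s
    w = weight (reverse (toList xs)) (toList s)
    fixed : ∀ a → count (λ α → run (park x a (vacateᵛ x t)) xs α ≟ˢ just s) (tuples (suc n) k) ≡
                  ⟦ completes? x t a ⟧ * w
    fixed a with completes? x t a
    ... | yes completes = trans
      (trans (cong (λ m → count (λ α → run m xs α ≟ˢ just s) (tuples (suc n) k)) completes)
             (count-run xs s ys! (once ∘ there)))
      (sym (ℕ.+-identityʳ w))
    ... | no ¬completes = count-none (λ α → run (park x a (vacateᵛ x t)) xs α ≟ˢ just s) fails (tuples (suc n) k)
      where
      fails : ∀ α → run (park x a (vacateᵛ x t)) xs α ≢ just s
      fails α eq with park x a (vacateᵛ x t) in eq′
      ... | nothing with () ← trans (sym (run-nothing xs α)) eq
      ... | just t′ = ¬completes (cong just (run-determined xs α ys! xs#t′ eq))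
        where
        -- The later cars are absent from `vacateᵛ x t`, and parking x adds only x, which is not one
        -- of them.
        xs#t′ : ∀ {y} → y ∈ toList xs → just y ∉ toList t′
        xs#t′ y∈xs y∈t′ with Parked-∈ (park⇒Parked x a (vacateᵛ x t) eq′) y∈t′
        ... | inj₁ refl = Unique.Unique[x∷xs]⇒x∉xs xs! y∈xs
        ... | inj₂ y∈t  = ∉-vacateAll xs s y∈xs (vacateᵛ-⊆ x t y∈t)

module _ {n : ℕ} where
  open Weight {A = Fin n} Fin._≟_ public
  open Parking {A = Fin n} Fin._≟_ public

-- Permutations as arrangements

toList-unique⁺ : ∀ {n} {xs : Vec A n} → Vec.Unique xs → Unique (toList xs)
toList-unique⁺ Vec.[]         = []
toList-unique⁺ (x∉ Vec.∷ xs!) = Vec.toList⁺ x∉ ∷ toList-unique⁺ xs!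

toList-unique⁻ : ∀ {n} {xs : Vec A n} → Unique (toList xs) → Vec.Unique xs
toList-unique⁻ {xs = []}    []         = Vec.[]
toList-unique⁻ {xs = _ ∷ _} (x∉ ∷ xs!) = Vec.toList⁻ x∉ Vec.∷ toList-unique⁻ xs!

toList-surjective : ∀ {n} (xs : List A) → length xs ≡ n → ∃ λ (v : Vec A n) → toList v ≡ xs
toList-surjective xs refl = Vec.fromList xs , Vec.toList∘fromList xs

toList-injective : ∀ {n} {v w : Vec A n} → toList v ≡ toList w → v ≡ w
toList-injective {v = v} {w} eq = trans (sym (Vec.cast-is-id refl v)) (Vec.toList-injective refl v w eq)

-- Pigeonhole: each entry of `xs` cancels a copy in `ys`, and the length bound leaves nothing over.
unique∧⊆⇒↭ : ∀ {xs ys : List A} → Unique xs → (∀ {x} → x ∈ xs → x ∈ ys) → length ys ≤ length xs → xs ↭ ys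
unique∧⊆⇒↭ {ys = []}         []                xs⊆ys len = Perm.refl
unique∧⊆⇒↭ {xs = x ∷ xs} x∷xs!@(_ ∷ xs!) xs⊆ys len with ∈.∈-∃++ (xs⊆ys (here refl))
... | ys , zs , refl = Perm.trans
  (Perm.prep x (unique∧⊆⇒↭ xs! xs⊆ (ℕ.≤-pred (subst (_≤ _) (Perm.↭-length (Perm.shift x ys zs)) len))))
  (Perm.↭-sym (Perm.shift x ys zs))
  where
  xs⊆ : ∀ {y} → y ∈ xs → y ∈ ys ++ zs
  xs⊆ y∈xs with Perm.∈-resp-↭ (Perm.shift x ys zs) (xs⊆ys (there y∈xs))
  ... | here refl = contradiction y∈xs (Unique.Unique[x∷xs]⇒x∉xs x∷xs!)
  ... | there y∈  = y∈

unique⇒↭allFin : ∀ {n} {xs : List (Fin n)} → Unique xs → length xs ≡ n → xs ↭ allFin n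
unique⇒↭allFin xs! len = unique∧⊆⇒↭ xs! (λ {x} _ → ∈.∈-allFin x)
  (ℕ.≤-reflexive (trans (List.length-tabulate id) (sym len)))

∈-tuples : ∀ {n k} (α : Vec (Fin n) k) → α ∈ tuples n k
∈-tuples []      = here refl
∈-tuples (a ∷ α) = ∈.∈-cartesianProductWith⁺ _∷_ (∈.∈-allFin a) (∈-tuples α)

tuples-unique : ∀ n k → Unique (tuples n k)
tuples-unique n zero    = [] ∷ []
tuples-unique n (suc k) =
  Unique.cartesianProductWith⁺ _∷_ Vec.∷-injective (Unique.allFin⁺ n) (tuples-unique n k)

∈-S⁻ : ∀ {n} {σ : Vec (Fin n) n} → σ ∈ S n → Unique (toList σ)
∈-S⁻ {n} σ∈S = toList-unique⁺ (proj₂ (∈.∈-filter⁻ unique? {xs = tuples n n} σ∈S))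

-- Reversed because `weight` and `arrangements` treat the head as the last arrival.
latestFirst : ∀ n → List (Fin n)
latestFirst n = reverse (allFin n)

latestFirst-unique : ∀ n → Unique (latestFirst n)
latestFirst-unique n = Unique-resp-↭ (Perm.↭-sym (Perm.↭-reverse (allFin n))) (Unique.allFin⁺ n)

length-latestFirst : ∀ n → length (latestFirst n) ≡ n
length-latestFirst n = trans (List.length-reverse (allFin n)) (List.length-tabulate {n = n} id)

-- Both lists are free of repetition, and n distinct cars out of n always form a rearrangement of
-- all of them.
S↭arrangements : ∀ {n fuel} → n ≤ fuel → map toList (S n) ↭ arrangements fuel (latestFirst n)
S↭arrangements {n} {fuel} n≤fuel = unique∧set⇒↭
  (Unique.map⁺ toList-injective (Unique.filter⁺ unique? (tuples-unique n n)))
  (arrangements-unique fuel (latestFirst-unique n))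
  to from
  where
  to : ∀ {z} → z ∈ map toList (S n) → z ∈ arrangements fuel (latestFirst n)
  to z∈ with ∈.∈-map⁻ toList z∈
  ... | σ , σ∈S , refl = ∈-arrangements⁺ fuel (latestFirst n) (subst (_≤ fuel) (sym (length-latestFirst n)) n≤fuel)
    (Perm.trans (unique⇒↭allFin (∈-S⁻ σ∈S) (Vec.length-toList σ)) (Perm.↭-sym (Perm.↭-reverse (allFin n))))
  from : ∀ {z} → z ∈ arrangements fuel (latestFirst n) → z ∈ map toList (S n)
  from {z} z∈ with z↭ ← ∈-arrangements⁻ fuel (latestFirst n) z∈
    with toList-surjective z (trans (Perm.↭-length z↭) (length-latestFirst n))
  ... | σ , refl = ∈.∈-map⁺ toList (∈.∈-filter⁺ unique? (∈-tuples σ)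
    (toList-unique⁻ (Unique-resp-↭ (Perm.↭-sym z↭) (latestFirst-unique n))))

-- The fibres of φ

-- The labelling `f` is general because the induction step renames the remaining cars to `f ∘ suc`,
-- while the street keeps its labels.
foldl-park≡run : ∀ {n k} {A : Set} (_≟_ : DecidableEquality A)
  (f : Fin k → A) (α : Vec (Fin n) k) (m : Maybe (Vec (Maybe A) n)) →
  foldl (λ m i → m >>= park (f i) (lookup α i)) m (allFin k) ≡ Parking.run _≟_ m (Vec.tabulate f) α
foldl-park≡run {k = zero}  _≟_ f []      m = refl
foldl-park≡run {n} {suc k} {A} _≟_ f (a ∷ α) m = trans
  (cong (foldl step (m >>= park (f zero) a)) (sym (List.map-tabulate (λ i → i) Fin.suc)))
  (trans (List.foldl-map step Fin.suc (m >>= park (f zero) a) (allFin k))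
         (foldl-park≡run _≟_ (f ∘ suc) α (m >>= park (f zero) a)))
  where
  step : Maybe (Vec (Maybe A) n) → Fin (suc k) → Maybe (Vec (Maybe A) n)
  step m i = m >>= park (f i) (lookup (a ∷ α) i)

toList-allFin : ∀ n → toList (Vec.allFin n) ≡ allFin n
toList-allFin n = toList-tabulate id
  where
  toList-tabulate : ∀ {k} (f : Fin k → A) → toList (Vec.tabulate f) ≡ tabulate f
  toList-tabulate {k = zero}  f = refl
  toList-tabulate {k = suc k} f = cong (f zero ∷_) (toList-tabulate (f ∘ suc))

empty-street : ∀ {n} (t : Vec (Maybe A) n) → (∀ x → just x ∉ toList t) → t ≡ replicate n nothing
empty-street []            x∉t = refl
empty-street (nothing ∷ t) x∉t = cong (nothing ∷_) (empty-street t (λ x → x∉t x ∘ there))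
empty-street (just x ∷ t)  x∉t = contradiction (here refl) (x∉t x)

fibreSize : ∀ {n} → Vec (Fin n) n → ℕ
fibreSize σ = length (φ⁻¹ σ)

-- Vacating every car from the full street given by `σ` yields the empty street with which `outcome`
-- starts, so `count-run` applies.
fibreSize≡weight : ∀ {n} {σ : Vec (Fin n) n} → σ ∈ S n →
                   fibreSize σ ≡ weight (latestFirst n) (map just (toList σ))
-- `count-run` assumes at least one spot; without cars both sides compute to 1.
fibreSize≡weight {zero}  {[]} σ∈S = refl
fibreSize≡weight {n@(suc _)} {σ} σ∈S = begin
  length (filter φ? (filter isParkingFunction? (tuples n n)))
    ≡⟨ length-filter≡count φ? (PF n) ⟩
  count φ? (filter isParkingFunction? (tuples n n))
    ≡⟨ count-filter φ? isParkingFunction?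
         (λ {α} φα≐σ → subst (Maybe.Is-just) (sym φα≐σ) (MaybeAny.just tt)) (tuples n n) ⟩
  count φ? (tuples n n)
    ≡⟨ count-cong φ? run? (λ {α} → trans (sym (outcome≡run α))) (λ {α} → trans (outcome≡run α)) (tuples n n) ⟩
  count run? (tuples n n)
    ≡⟨ count-run cars s cars! once ⟩
  weight (reverse (toList cars)) (toList s)
    ≡⟨ cong₂ (λ xs t → weight (reverse xs) t) (toList-allFin n) (Vec.toList-map just σ) ⟩
  weight (latestFirst n) (map just (toList σ))  ∎
  where
  open ≡-Reasoning
  cars = Vec.allFin n
  s = Vec.map just σ
  φ? : Decidable (φ[_]≐ σ)
  φ? α = φ[ α ]≐? σ
  run? : Decidable λ α → run (just (vacateAll cars s)) cars α ≡ just s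
  run? α = run (just (vacateAll cars s)) cars α ≟ˢ just s
  cars! : Unique (toList cars)
  cars! = subst Unique (sym (toList-allFin n)) (Unique.allFin⁺ n)
  ∈-cars : ∀ x → x ∈ toList cars
  ∈-cars x = subst (x ∈_) (sym (toList-allFin n)) (∈.∈-allFin x)
  outcome≡run : ∀ α → outcome α ≡ run (just (vacateAll cars s)) cars α
  outcome≡run α = trans (foldl-park≡run Fin._≟_ id α (just (replicate n nothing)))
    (cong (λ t → run (just t) cars α)
      (sym (empty-street (vacateAll cars s) (λ x → ∉-vacateAll cars s (∈-cars x)))))
  once : ∀ {x} → x ∈ toList cars → Once x (toList s)
  once {x} _ = subst (Once x) (sym (Vec.toList-map just σ)) (∈⇒Once (∈-S⁻ σ∈S)
    (Perm.∈-resp-↭ (Perm.↭-sym (unique⇒↭allFin (∈-S⁻ σ∈S) (Vec.length-toList σ))) (∈.∈-allFin x)))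

fibreSizes-S : ∀ {n fuel} → n ≤ fuel → map fibreSize (S n) ↭ fibreSizes fuel n
fibreSizes-S {n} {fuel} n≤fuel = begin
  map fibreSize (S n)
    ≡⟨ List.map-cong-local (All.tabulate fibreSize≡weight) ⟩
  map (weight (latestFirst n) ∘ map just ∘ toList) (S n)
    ≡⟨ List.map-∘ (S n) ⟩
  map (weight (latestFirst n) ∘ map just) (map toList (S n))
    ↭⟨ Perm.map⁺ (weight (latestFirst n) ∘ map just) (S↭arrangements n≤fuel) ⟩
  weights fuel (latestFirst n)
    ≡⟨ weights≡fibreSizes fuel (latestFirst-unique n) ⟩
  fibreSizes fuel (length (latestFirst n))
    ≡⟨ cong (fibreSizes fuel) (length-latestFirst n) ⟩
  fibreSizes fuel n  ∎
  where open Perm.PermutationReasoning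

-- Fuel may exceed n, so that parts of different sizes can be read off with one common fuel.
G≈∑q^ln-fibreSizes : ∀ {n fuel} → n ≤ fuel → G n ≈ ∑q^ln (fibreSizes fuel n)
G≈∑q^ln-fibreSizes {n} {fuel} n≤fuel = ≈-trans
  (G≈∑q^ln n (All.tabulate λ σ∈S → fibreSizes-≤ fuel n
    (Perm.∈-resp-↭ (fibreSizes-S n≤fuel) (∈.∈-map⁺ fibreSize σ∈S))))
  (∑q^ln-resp-↭ (fibreSizes-S n≤fuel))

-- Assembling the recurrence from the fibre sizes

concatMap-≈-local : ∀ {f g : A → FormalSum} {xs} → All (λ x → f x ≈ g x) xs → concatMap f xs ≈ concatMap g xs
concatMap-≈-local []            = ≈-refl
concatMap-≈-local (fx≈gx ∷ f≈g) = ⊕-cong fx≈gx (concatMap-≈-local f≈g)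

proposition4p2 : (n : ℕ) → 1 ≤ n →
    G n ≈ ∑[ i < n ] ((n ∸ 1) C i) · (q^ ln (suc i) ⊗ G i ⊗ G (n ∸ 1 ∸ i))
proposition4p2 (suc n) _ = begin
  G (suc n)
    ≈⟨ G≈∑q^ln-fibreSizes {suc n} ℕ.≤-refl ⟩
  ∑q^ln (fibreSizes (suc n) (suc n))
    -- Fuel `suc n` unfolds once and leaves fuel n for both parts, which suffices as i and n ∸ i are
    -- at most n.
    ≡⟨ ∑q^ln-concatMap (λ i → products (map (suc i *_) (sizes i)) (sizes (n ∸ i))) (subsetSizes n) ⟩
  concatMap (λ i → ∑q^ln (products (map (suc i *_) (sizes i)) (sizes (n ∸ i)))) (subsetSizes n)
    ≈⟨ concatMap-≈-local (All.map factor (subsetSizes≤ n)) ⟩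
  concatMap (λ i → q^ ln (suc i) ⊗ G i ⊗ G (n ∸ i)) (subsetSizes n)
    ≈⟨ concatMap-subsetSizes n (λ i → q^ ln (suc i) ⊗ G i ⊗ G (n ∸ i)) ⟩
  ∑[ i < suc n ] (n C i) · (q^ ln (suc i) ⊗ G i ⊗ G (n ∸ i))  ∎
  where
  open ≈-Reasoning
  sizes : ℕ → List ℕ
  sizes = fibreSizes n
  factor : ∀ {i} → i ≤ n → ∑q^ln (products (map (suc i *_) (sizes i)) (sizes (n ∸ i))) ≈
                           q^ ln (suc i) ⊗ G i ⊗ G (n ∸ i)
  factor {i} i≤n = begin
    ∑q^ln (products (map (suc i *_) (sizes i)) (sizes (n ∸ i)))
      ≈⟨ ∑q^ln-products (map (suc i *_) (sizes i)) (sizes (n ∸ i)) ⟩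
    ∑q^ln (map (suc i *_) (sizes i)) ⊗ ∑q^ln (sizes (n ∸ i))
      ≈⟨ ⊗-congˡ (∑q^ln (sizes (n ∸ i))) (∑q^ln-scale (suc i) (sizes i)) ⟩
    q^ ln (suc i) ⊗ ∑q^ln (sizes i) ⊗ ∑q^ln (sizes (n ∸ i))
      ≈⟨ ⊗-cong (⊗-congʳ (q^ ln (suc i)) (G≈∑q^ln-fibreSizes i≤n)) (G≈∑q^ln-fibreSizes (ℕ.m∸n≤m n i)) ⟨
    q^ ln (suc i) ⊗ G i ⊗ G (n ∸ i)  ∎
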